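{- Let $r$ be a positive integer, let $G_r=(V,E)$ be the Chimera graph, and let $c_{uv}\in\mathbb{R}$ for $(u,v)\in E$ and $d_u\in\mathbb{R}$ for $u\in V$ be arbitrary. Let $H^*=\min_{S\in\{ -1,1\}^V}\left(\sum_{(u,v)\in E}c_{uv}S_uS_v+\sum_{u\in V}d_uS_u\right)$. Then $$H^*\le -\frac{C}{3C+4}\left[\sum_{(u,v)\in E}|c_{uv}|+\sum_{u\in V}|d_u|\right]$$ for some constant $C>\frac{\ln(1+\sqrt{2})}{\pi}$ (independent of $r$ and of the coefficients). In particular, the approximation factor $(3C+4)/C$ satisfies $(3C+4)/C<17.26$.
   Context: The Chimera graph $G_r=(V,E)$: $V=\{(i,j,k,l)\in\mathbb{Z}^4: 1\le i,j\le r,\ 1\le k\le 4,\ l\in\{0,1\}\}$. $E=E_0\cup E_1\cup E_{01}$ (disjoint), where $E_0$ consists of the edges $\{(i,j,k,0),(i+1,j,k,0)\}$ for $1\le i\le r-1$, $1\le j\le r$, $1\le k\le 4$; $E_1$ consists of the edges $\{(i,j,k,1),(i,j+1,k,1)\}$ for $1\le i\le r$, $1\le j\le r-1$, $1\le k\le 4$; and $E_{01}$ consists of the edges $\{(i,j,k_0,0),(i,j,k_1,1)\}$ for $1\le i,j\le r$, $1\le k_0,k_1\le 4$. -}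

module Defs where

open import Data.Fin.Base as Fin using (Fin; inject₁)
open import Data.Integer.Base as ℤ using (+_; -[1+_]; +[1+_])
import Data.Integer.Properties as ℤ
open import Data.List.Base as List using (List; []; _∷_)
open import Data.Nat.Base as ℕ using (ℕ; zero; suc)
import Data.Nat.Properties as ℕ
open import Data.Product using (∃; _×_; _,_; proj₁; proj₂)
open import Data.Rational.Base as ℚ using (ℚ; 0ℚ; 1ℚ; ½; _/_; mkℚ)
import Data.Rational.Properties as ℚ
open import Data.Sign.Base as Sign using (Sign)
open import Data.Sum using (inj₁; inj₂)
import Data.Vec.Functional as Vector
open import Relation.Binary.PropositionalEquality
open import Relation.Nullary using (yes; no; contradiction)

Small : (ℕ → ℕ → ℚ) → Set
Small D = ∀ ε → 0ℚ ℚ.< ε → ∃ λ N → ∀ m n → N ℕ.≤ m → N ℕ.≤ n → D m n ℚ.≤ ε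

Cauchy : (ℕ → ℚ) → Set
Cauchy f = Small (λ m n → ℚ.∣ f m ℚ.- f n ∣)

-- Σ_{k<n} a k · w^k, in Horner form.
partialSum : (ℕ → ℚ) → ℕ → ℚ → ℚ
partialSum a zero    w = 0ℚ
partialSum a (suc n) w = a 0 ℚ.+ w ℚ.* partialSum (λ k → a (suc k)) n w

-- The value at 0 is a dummy; real division only uses sequences that are
-- eventually bounded away from 0.
inverse : ℚ → ℚ
inverse p with p ℚ.≟ 0ℚ
... | yes _   = 0ℚ
... | no  p≢0 = ℚ.1/_ p {{ℚ.≢-nonZero p≢0}}

bump : ℕ → ℕ → ℕ
bump n s with suc s ℕ.* suc s ℕ.≤? n
... | yes _ = suc s
... | no  _ = s

-- The largest s with s * s ≤ n.
⌊√_⌋ : ℕ → ℕ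
⌊√ zero  ⌋ = 0
⌊√ suc n ⌋ = bump (suc n) ⌊√ n ⌋

-- ⌊(n+1)√m⌋ / (n+1).
√-approx : ℕ → ℕ → ℚ
√-approx m n = + ⌊√ m ℕ.* (suc n ℕ.* suc n) ⌋ / suc n

odd-reciprocal : ℕ → ℚ
odd-reciprocal k = + 1 / suc (2 ℕ.* k)

module Estimates where

  open import Data.Rational.Base hiding (_/_)
  open import Data.Rational.Properties
  open import Data.Rational.Solver
  open +-*-Solver using (solve; _:=_; _:+_; _:*_; _:-_; :-_; con)
  import Data.Rational.Unnormalised.Base as ℚᵘ
  import Data.Rational.Unnormalised.Properties as ℚᵘ

  *-monoʳ : ∀ {p q r} → 0ℚ ≤ r → p ≤ q → r * p ≤ r * q
  *-monoʳ {r = r} 0≤r = *-monoˡ-≤-nonNeg r {{nonNegative 0≤r}}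

  *-monoˡ : ∀ {p q r} → 0ℚ ≤ r → p ≤ q → p * r ≤ q * r
  *-monoˡ {r = r} 0≤r = *-monoʳ-≤-nonNeg r {{nonNegative 0≤r}}

  *-mono : ∀ {p q r s} → 0ℚ ≤ p → 0ℚ ≤ s → p ≤ q → r ≤ s → p * r ≤ q * s
  *-mono 0≤p 0≤s p≤q r≤s = ≤-trans (*-monoʳ 0≤p r≤s) (*-monoˡ 0≤s p≤q)

  0<* : ∀ {p q} → 0ℚ < p → 0ℚ < q → 0ℚ < p * q
  0<* {p} {q} 0<p 0<q =
    positive⁻¹ (p * q) {{pos*pos⇒pos p {{positive 0<p}} q {{positive 0<q}}}}

  0≤* : ∀ {p q} → 0ℚ ≤ p → 0ℚ ≤ q → 0ℚ ≤ p * q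
  0≤* {p} {q} 0≤p 0≤q = nonNegative⁻¹ (p * q)
    {{nonNeg*nonNeg⇒nonNeg p {{nonNegative 0≤p}} q {{nonNegative 0≤q}}}}

  0≤1 : 0ℚ ≤ 1ℚ
  0≤1 = nonNegative⁻¹ 1ℚ

  0<½ : 0ℚ < ½
  0<½ = positive⁻¹ ½

  recip : ∀ {p} → 0ℚ < p → ∃ λ q → 0ℚ < q × q * p ≡ 1ℚ
  recip {p} 0<p = (1/ p) {{>-nonZero 0<p}}
    , positive⁻¹ _ {{1/pos⇒pos p {{positive 0<p}}}}
    , *-inverseˡ p {{>-nonZero 0<p}}

  halves : ∀ ε → ε * ½ + ε * ½ ≡ ε
  halves ε = trans (sym (*-distribˡ-+ ε ½ ½)) (*-identityʳ ε)

  p≤∣p∣ : ∀ p → p ≤ ∣ p ∣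
  p≤∣p∣ p with ≤-total 0ℚ p
  ... | inj₁ 0≤p = ≤-reflexive (sym (0≤p⇒∣p∣≡p 0≤p))
  ... | inj₂ p≤0 = ≤-trans p≤0 (0≤∣p∣ p)

  -p≤∣p∣ : ∀ p → - p ≤ ∣ p ∣
  -p≤∣p∣ p = subst (- p ≤_) (∣-p∣≡∣p∣ p) (p≤∣p∣ (- p))

  abs-≤ : ∀ {p e} → p ≤ e → - p ≤ e → ∣ p ∣ ≤ e
  abs-≤ {p} p≤e -p≤e with ∣p∣≡p∨∣p∣≡-p p
  ... | inj₁ eq = subst (_≤ _) (sym eq) p≤e
  ... | inj₂ eq = subst (_≤ _) (sym eq) -p≤e

  neg-sub : ∀ p q → - (p - q) ≡ q - p
  neg-sub = solve 2 (λ p q → :- (p :- q) := q :- p) refl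

  ∣-∣-comm : ∀ p q → ∣ p - q ∣ ≡ ∣ q - p ∣
  ∣-∣-comm p q = trans (sym (∣-p∣≡∣p∣ (p - q))) (cong ∣_∣ (neg-sub p q))

  sub-≤ : ∀ {p q e} → p ≤ q + e → p - q ≤ e
  sub-≤ {p} {q} {e} h = subst (p - q ≤_)
    (solve 2 (λ q e → q :+ e :- q := e) refl q e) (+-monoˡ-≤ (- q) h)

  ≤-sub : ∀ {p q e} → p - q ≤ e → p ≤ q + e
  ≤-sub {p} {q} {e} h = subst (_≤ q + e)
    (solve 2 (λ p q → q :+ (p :- q) := p) refl p q) (+-monoʳ-≤ q h)

  ∣-∣-≤ : ∀ {p q e} → p ≤ q + e → q ≤ p + e → ∣ p - q ∣ ≤ e
  ∣-∣-≤ {p} {q} h k = abs-≤ (sub-≤ h) (subst (_≤ _) (sym (neg-sub p q)) (sub-≤ k))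

  ≤-∣-∣ : ∀ p q → p ≤ q + ∣ p - q ∣
  ≤-∣-∣ p q = ≤-sub (p≤∣p∣ (p - q))

  triangle : ∀ p q r → ∣ p - r ∣ ≤ ∣ p - q ∣ + ∣ q - r ∣
  triangle p q r = subst (λ t → ∣ t ∣ ≤ ∣ p - q ∣ + ∣ q - r ∣)
    (solve 3 (λ p q r → (p :- q) :+ (q :- r) := p :- r) refl p q r)
    (∣p+q∣≤∣p∣+∣q∣ (p - q) (q - r))

  /-≤ : ∀ a b c d .{{_ : ℕ.NonZero b}} .{{_ : ℕ.NonZero d}} →
        a ℕ.* d ℕ.≤ c ℕ.* b → + a / b ≤ + c / d
  /-≤ a (suc b) c (suc d) h = toℚᵘ-cancel-≤
    (ℚᵘ.≤-respˡ-≃ (ℚᵘ.≃-sym (toℚᵘ-fromℚᵘ (ℚᵘ.mkℚᵘ (+ a) b)))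
    (ℚᵘ.≤-respʳ-≃ (ℚᵘ.≃-sym (toℚᵘ-fromℚᵘ (ℚᵘ.mkℚᵘ (+ c) d)))
      (ℚᵘ.*≤* (subst₂ ℤ._≤_ (ℤ.pos-* a (suc d)) (ℤ.pos-* c (suc b)) (ℤ.+≤+ h)))))

  /-suc : ∀ a b → + suc a / suc b ≡ + a / suc b + + 1 / suc b
  /-suc a b = toℚᵘ-injective (ℚᵘ.≃-trans (toℚᵘ-fromℚᵘ (ℚᵘ.mkℚᵘ (+ suc a) b))
    (ℚᵘ.≃-sym (ℚᵘ.≃-trans (toℚᵘ-homo-+ (+ a / suc b) (+ 1 / suc b))
      (ℚᵘ.≃-trans (ℚᵘ.+-cong (toℚᵘ-fromℚᵘ (ℚᵘ.mkℚᵘ (+ a) b)) (toℚᵘ-fromℚᵘ (ℚᵘ.mkℚᵘ (+ 1) b)))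
        (ℚᵘ.*≡* eq)))))
    where
    eq : (+ a ℤ.* + suc b ℤ.+ + 1 ℤ.* + suc b) ℤ.* + suc b ≡ + suc a ℤ.* + (suc b ℕ.* suc b)
    eq = trans (cong (ℤ._* + suc b) (sym (ℤ.*-distribʳ-+ (+ suc b) (+ a) (+ 1))))
       (trans (ℤ.*-assoc (+ a ℤ.+ + 1) (+ suc b) (+ suc b))
         (cong₂ ℤ._*_ (cong +_ (ℕ.+-comm a 1)) (sym (ℤ.pos-* (suc b) (suc b)))))

  0≤/ : ∀ a b .{{_ : ℕ.NonZero b}} → 0ℚ ≤ + a / b
  0≤/ a b = nonNegative⁻¹ _ {{normalize-nonNeg a b}}

  archimedean : ∀ p → ∃ λ n → p ≤ + n / 1
  archimedean p with ↥ p in eq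
  ... | + n      = n , subst (_≤ + n / 1) (trans (cong (_/ ↧ₙ p) (sym eq)) (↥p/↧p≡p p))
                       (/-≤ n (↧ₙ p) n 1 (ℕ.*-monoʳ-≤ n (ℕ.s≤s ℕ.z≤n)))
  ... | -[1+ n ] = 0 , subst (_≤ 0ℚ) (trans (cong (_/ ↧ₙ p) (sym eq)) (↥p/↧p≡p p))
                       (neg-antimono-≤ (0≤/ (suc n) (↧ₙ p)))

  1/n-small : ∀ ε → 0ℚ < ε → ∃ λ N → ∀ n → N ℕ.≤ n → + 1 / suc n ≤ ε
  1/n-small ε@(mkℚ +[1+ p ] d _) _ = d , λ n d≤n → subst (_ ≤_) (↥p/↧p≡p ε)
    (/-≤ 1 (suc n) (suc p) (suc d)
      (ℕ.*-mono-≤ {1} {suc p} {suc d} {suc n} (ℕ.s≤s ℕ.z≤n) (ℕ.s≤s d≤n)))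
  1/n-small (mkℚ (+ 0) d _) (*<* (ℤ.+<+ ()))
  1/n-small (mkℚ -[1+ p ] d _) (*<* ())

  small-≤ : ∀ {D E} N → (∀ m n → N ℕ.≤ m → N ℕ.≤ n → D m n ≤ E m n) → Small E → Small D
  small-≤ N h small ε 0<ε with small ε 0<ε
  ... | M , k = N ℕ.⊔ M , λ m n p q → ≤-trans
    (h m n (ℕ.≤-trans (ℕ.m≤m⊔n N M) p) (ℕ.≤-trans (ℕ.m≤m⊔n N M) q))
    (k m n (ℕ.≤-trans (ℕ.m≤n⊔m N M) p) (ℕ.≤-trans (ℕ.m≤n⊔m N M) q))

  small-+ : ∀ {D E} → Small D → Small E → Small (λ m n → D m n + E m n)
  small-+ s t ε 0<ε with s (ε * ½) (0<* 0<ε 0<½) | t (ε * ½) (0<* 0<ε 0<½)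
  ... | M , h | N , k = M ℕ.⊔ N , λ m n p q → subst (_ ≤_) (halves ε) (+-mono-≤
    (h m n (ℕ.≤-trans (ℕ.m≤m⊔n M N) p) (ℕ.≤-trans (ℕ.m≤m⊔n M N) q))
    (k m n (ℕ.≤-trans (ℕ.m≤n⊔m M N) p) (ℕ.≤-trans (ℕ.m≤n⊔m M N) q)))

  small-* : ∀ {D} K → 0ℚ < K → Small D → Small (λ m n → K * D m n)
  small-* K 0<K s ε 0<ε with recip 0<K
  ... | L , 0<L , LK≡1 with s (L * ε) (0<* 0<L 0<ε)
  ... | N , h = N , λ m n p q → subst (_ ≤_)
    (trans (solve 3 (λ K L ε → K :* (L :* ε) := (L :* K) :* ε) refl K L ε)
      (trans (cong (_* ε) LK≡1) (*-identityˡ ε)))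
    (*-monoʳ (<⇒≤ 0<K) (h m n p q))

  bounded : ∀ (f : ℕ → ℚ) → Cauchy f →
            ∃ λ K → 0ℚ < K × ∃ λ N → ∀ n → N ℕ.≤ n → ∣ f n ∣ ≤ K
  bounded f s with s 1ℚ (positive⁻¹ 1ℚ)
  ... | N , h = 1ℚ + ∣ f N ∣ , +-mono-<-≤ (positive⁻¹ 1ℚ) (0≤∣p∣ (f N)) , N , λ n N≤n →
    ≤-trans (subst (λ t → ∣ t ∣ ≤ ∣ f n - f N ∣ + ∣ f N ∣)
              (solve 2 (λ p q → p :- q :+ q := p) refl (f n) (f N))
              (∣p+q∣≤∣p∣+∣q∣ (f n - f N) (f N)))
            (+-monoˡ-≤ ∣ f N ∣ (h n N N≤n ℕ.≤-refl))

  ∣*-*∣-≤ : ∀ {p q r s K L} → ∣ p ∣ ≤ K → ∣ s ∣ ≤ L →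
            ∣ p * r - q * s ∣ ≤ K * ∣ r - s ∣ + L * ∣ p - q ∣
  ∣*-*∣-≤ {p} {q} {r} {s} {K} {L} p≤K s≤L = begin
    ∣ p * r - q * s ∣                   ≡⟨ cong ∣_∣ (solve 4 (λ p q r s → p :* r :- q :* s := p :* (r :- s) :+ s :* (p :- q)) refl p q r s) ⟩
    ∣ p * (r - s) + s * (p - q) ∣       ≤⟨ ∣p+q∣≤∣p∣+∣q∣ (p * (r - s)) (s * (p - q)) ⟩
    ∣ p * (r - s) ∣ + ∣ s * (p - q) ∣   ≡⟨ cong₂ _+_ (∣p*q∣≡∣p∣*∣q∣ p (r - s)) (∣p*q∣≡∣p∣*∣q∣ s (p - q)) ⟩
    ∣ p ∣ * ∣ r - s ∣ + ∣ s ∣ * ∣ p - q ∣ ≤⟨ +-mono-≤ (*-monoˡ (0≤∣p∣ (r - s)) p≤K) (*-monoˡ (0≤∣p∣ (p - q)) s≤L) ⟩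
    K * ∣ r - s ∣ + L * ∣ p - q ∣       ∎
    where open ≤-Reasoning

  ∣∣-∣∣-≤ : ∀ p q → ∣ ∣ p ∣ - ∣ q ∣ ∣ ≤ ∣ p - q ∣
  ∣∣-∣∣-≤ p q = ∣-∣-≤ (half p q) (subst (λ t → ∣ q ∣ ≤ ∣ p ∣ + t) (∣-∣-comm q p) (half q p))
    where
    half : ∀ p q → ∣ p ∣ ≤ ∣ q ∣ + ∣ p - q ∣
    half p q = subst (λ t → ∣ t ∣ ≤ ∣ q ∣ + ∣ p - q ∣)
      (solve 2 (λ p q → q :+ (p :- q) := p) refl p q) (∣p+q∣≤∣p∣+∣q∣ q (p - q))

  ∣⊓-⊓∣-≤ : ∀ p q r s → ∣ p ⊓ q - r ⊓ s ∣ ≤ ∣ p - r ∣ + ∣ q - s ∣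
  ∣⊓-⊓∣-≤ p q r s = ∣-∣-≤ (half p q r s)
    (subst (λ t → r ⊓ s ≤ p ⊓ q + t) (cong₂ _+_ (∣-∣-comm r p) (∣-∣-comm s q)) (half r s p q))
    where
    x≤ : ∀ {x} y z {w} → x ≤ y + z → 0ℚ ≤ w → x ≤ y + (z + w)
    x≤ y z {w} h 0≤w = ≤-trans h (+-monoʳ-≤ y
      (subst (_≤ z + w) (+-identityʳ z) (+-monoʳ-≤ z 0≤w)))
    half : ∀ p q r s → p ⊓ q ≤ r ⊓ s + (∣ p - r ∣ + ∣ q - s ∣)
    half p q r s with ⊓-sel r s
    ... | inj₁ eq = subst (λ t → p ⊓ q ≤ t + (∣ p - r ∣ + ∣ q - s ∣)) (sym eq)
          (≤-trans (p⊓q≤p p q) (x≤ r ∣ p - r ∣ (≤-∣-∣ p r) (0≤∣p∣ (q - s))))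
    ... | inj₂ eq = subst₂ (λ t u → p ⊓ q ≤ t + u) (sym eq) (+-comm ∣ q - s ∣ ∣ p - r ∣)
          (≤-trans (p⊓q≤q p q) (x≤ s ∣ q - s ∣ (≤-∣-∣ q s) (0≤∣p∣ (p - r))))

  inverseˡ : ∀ {p} → 0ℚ < p → inverse p * p ≡ 1ℚ
  inverseˡ {p} 0<p with p ≟ 0ℚ
  ... | yes p≡0 = contradiction (sym p≡0) (<⇒≢ 0<p)
  ... | no  p≢0 = *-inverseˡ p {{≢-nonZero p≢0}}

  0≤inverse : ∀ {p} → 0ℚ < p → 0ℚ ≤ inverse p
  0≤inverse {p} 0<p with p ≟ 0ℚ
  ... | yes _   = ≤-refl
  ... | no  p≢0 = <⇒≤ (positive⁻¹ _ {{1/pos⇒pos p {{positive 0<p}}}})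

  inverse-≤ : ∀ {δ δ⁻¹ p} → 0ℚ < δ → 0ℚ < δ⁻¹ → δ⁻¹ * δ ≡ 1ℚ → δ ≤ p → inverse p ≤ δ⁻¹
  inverse-≤ {δ} {δ⁻¹} {p} 0<δ 0<δ⁻¹ eq δ≤p = subst₂ _≤_
    (trans (sym (*-assoc (inverse p) δ⁻¹ δ)) (trans (*-assoc (inverse p) δ⁻¹ δ)
      (trans (cong (inverse p *_) eq) (*-identityʳ _))))
    (trans (solve 3 (λ i d p → i :* (d :* p) := d :* (i :* p)) refl (inverse p) δ⁻¹ p)
      (trans (cong (δ⁻¹ *_) (inverseˡ 0<p)) (*-identityʳ _)))
    (*-monoʳ (0≤inverse 0<p) (*-monoʳ (<⇒≤ 0<δ⁻¹) δ≤p))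
    where 0<p = <-≤-trans 0<δ δ≤p

  ∣inverse-inverse∣-≤ : ∀ {δ δ⁻¹ p q} → 0ℚ < δ → 0ℚ < δ⁻¹ → δ⁻¹ * δ ≡ 1ℚ → δ ≤ p → δ ≤ q →
    ∣ inverse p - inverse q ∣ ≤ (δ⁻¹ * δ⁻¹) * ∣ p - q ∣
  ∣inverse-inverse∣-≤ {δ} {δ⁻¹} {p} {q} 0<δ 0<δ⁻¹ eq δ≤p δ≤q = begin
    ∣ i - j ∣                         ≡⟨ cong ∣_∣ diff ⟩
    ∣ (i * j) * (q - p) ∣             ≡⟨ ∣p*q∣≡∣p∣*∣q∣ (i * j) (q - p) ⟩
    ∣ i * j ∣ * ∣ q - p ∣             ≡⟨ cong₂ _*_ (0≤p⇒∣p∣≡p (0≤* 0≤i 0≤j)) (∣-∣-comm q p) ⟩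
    (i * j) * ∣ p - q ∣               ≤⟨ *-monoˡ (0≤∣p∣ (p - q)) (*-mono 0≤i (<⇒≤ 0<δ⁻¹) (inverse-≤ 0<δ 0<δ⁻¹ eq δ≤p) (inverse-≤ 0<δ 0<δ⁻¹ eq δ≤q)) ⟩
    (δ⁻¹ * δ⁻¹) * ∣ p - q ∣           ∎
    where
    open ≤-Reasoning
    i = inverse p
    j = inverse q
    0≤i = 0≤inverse (<-≤-trans 0<δ δ≤p)
    0≤j = 0≤inverse (<-≤-trans 0<δ δ≤q)
    diff : i - j ≡ (i * j) * (q - p)
    diff = sym (trans
      (solve 4 (λ i j p q → (i :* j) :* (q :- p) := i :* (j :* q) :- j :* (i :* p)) refl i j p q)
      (cong₂ _-_ (trans (cong (i *_) (inverseˡ (<-≤-trans 0<δ δ≤q))) (*-identityʳ i))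
                 (trans (cong (j *_) (inverseˡ (<-≤-trans 0<δ δ≤p))) (*-identityʳ j))))

  bump-lower : ∀ n s → s ℕ.* s ℕ.≤ n → bump (suc n) s ℕ.* bump (suc n) s ℕ.≤ suc n
  bump-lower n s s²≤n with suc s ℕ.* suc s ℕ.≤? suc n
  ... | yes h = h
  ... | no  _ = ℕ.m≤n⇒m≤1+n s²≤n

  bump-upper : ∀ n s → n ℕ.< suc s ℕ.* suc s →
    suc n ℕ.< suc (bump (suc n) s) ℕ.* suc (bump (suc n) s)
  bump-upper n s n< with suc s ℕ.* suc s ℕ.≤? suc n
  ... | no  h = ℕ.≰⇒> h
  ... | yes _ = ℕ.≤-trans (ℕ.s≤s n<) (ℕ.*-mono-< (ℕ.n<1+n (suc s)) (ℕ.n<1+n (suc s)))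

  ⌊√⌋-lower : ∀ n → ⌊√ n ⌋ ℕ.* ⌊√ n ⌋ ℕ.≤ n
  ⌊√⌋-lower zero    = ℕ.z≤n
  ⌊√⌋-lower (suc n) = bump-lower n ⌊√ n ⌋ (⌊√⌋-lower n)

  ⌊√⌋-upper : ∀ n → n ℕ.< suc ⌊√ n ⌋ ℕ.* suc ⌊√ n ⌋
  ⌊√⌋-upper zero    = ℕ.s≤s ℕ.z≤n
  ⌊√⌋-upper (suc n) = bump-upper n ⌊√ n ⌋ (⌊√⌋-upper n)

  √-approx-≤ : ∀ m n k → √-approx m n ≤ √-approx m k + + 1 / suc k
  √-approx-≤ m n k = subst (√-approx m n ≤_) (/-suc t k) (/-≤ s (suc n) (suc t) (suc k) (ℕ.≮⇒≥ lemma))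
    where
    open import Data.Nat.Solver using () renaming (module +-*-Solver to N)
    open import Data.Empty using (⊥)
    s = ⌊√ m ℕ.* (suc n ℕ.* suc n) ⌋
    t = ⌊√ m ℕ.* (suc k ℕ.* suc k) ⌋
    sq : ∀ a b → (a ℕ.* b) ℕ.* (a ℕ.* b) ≡ (a ℕ.* a) ℕ.* (b ℕ.* b)
    sq = N.solve 2 (λ a b → (a N.:* b) N.:* (a N.:* b) N.:= (a N.:* a) N.:* (b N.:* b)) refl
    mid : (m ℕ.* (suc k ℕ.* suc k)) ℕ.* (suc n ℕ.* suc n) ≡ (m ℕ.* (suc n ℕ.* suc n)) ℕ.* (suc k ℕ.* suc k)
    mid = N.solve 3 (λ m x y → (m N.:* x) N.:* y N.:= (m N.:* y) N.:* x) refl m (suc k ℕ.* suc k) (suc n ℕ.* suc n)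
    low : (s ℕ.* suc k) ℕ.* (s ℕ.* suc k) ℕ.≤ (m ℕ.* (suc n ℕ.* suc n)) ℕ.* (suc k ℕ.* suc k)
    low = subst (ℕ._≤ (m ℕ.* (suc n ℕ.* suc n)) ℕ.* (suc k ℕ.* suc k)) (sym (sq s (suc k))) (ℕ.*-monoˡ-≤ (suc k ℕ.* suc k) (⌊√⌋-lower (m ℕ.* (suc n ℕ.* suc n))))
    up : (m ℕ.* (suc k ℕ.* suc k)) ℕ.* (suc n ℕ.* suc n) ℕ.≤ (suc t ℕ.* suc n) ℕ.* (suc t ℕ.* suc n)
    up = subst ((m ℕ.* (suc k ℕ.* suc k)) ℕ.* (suc n ℕ.* suc n) ℕ.≤_) (sym (sq (suc t) (suc n))) (ℕ.*-monoˡ-≤ (suc n ℕ.* suc n) (ℕ.<⇒≤ (⌊√⌋-upper (m ℕ.* (suc k ℕ.* suc k)))))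
    lemma : suc t ℕ.* suc n ℕ.< s ℕ.* suc k → ⊥
    lemma h = ℕ.<-irrefl refl (ℕ.<-≤-trans (ℕ.*-mono-< h h)
      (ℕ.≤-trans low (subst (ℕ._≤ (suc t ℕ.* suc n) ℕ.* (suc t ℕ.* suc n)) mid up)))

  √-cauchy : ∀ k → Cauchy (√-approx k)
  √-cauchy k ε 0<ε with 1/n-small ε 0<ε
  ... | N , h = N , λ m n N≤m N≤n → ∣-∣-≤
    (≤-trans (√-approx-≤ k m n) (+-monoʳ-≤ (√-approx k n) (h n N≤n)))
    (≤-trans (√-approx-≤ k n m) (+-monoʳ-≤ (√-approx k m) (h m N≤m)))

  pow : ℚ → ℕ → ℚ
  pow q zero    = 1ℚ
  pow q (suc n) = q * pow q n

  -- Bounds for |a k| ≤ 1 and |w| ≤ q ≤ 1 − η, where B = 1/η.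
  module Geometric {q η B} (0≤q : 0ℚ ≤ q) (0<η : 0ℚ < η) (q+η≤1 : q + η ≤ 1ℚ)
                   (0<B : 0ℚ < B) (Bη≡1 : B * η ≡ 1ℚ) where

    0≤pow : ∀ n → 0ℚ ≤ pow q n
    0≤pow zero    = 0≤1
    0≤pow (suc n) = 0≤* 0≤q (0≤pow n)

    bernoulli : ∀ n → pow q n * (1ℚ + (+ n / 1) * η) ≤ 1ℚ
    bernoulli zero = ≤-reflexive (trans (*-identityˡ _) (trans (cong (_+_ 1ℚ) (*-zeroˡ η)) (+-identityʳ 1ℚ)))
    bernoulli (suc n) = begin
      (q * P) * (1ℚ + (+ suc n / 1) * η)  ≡⟨ cong (λ t → (q * P) * (1ℚ + t * η)) (/-suc n 0) ⟩
      (q * P) * (1ℚ + (x + 1ℚ) * η)       ≡⟨ solve 5 (λ o q P x η → (q :* P) :* (o :+ (x :+ o) :* η) := P :* (q :* (o :+ (x :+ o) :* η))) refl 1ℚ q P x η ⟩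
      P * (q * (1ℚ + (x + 1ℚ) * η))       ≤⟨ *-monoʳ (0≤pow n) step ⟩
      P * (1ℚ + x * η)                    ≤⟨ bernoulli n ⟩
      1ℚ                                  ∎
      where
      open ≤-Reasoning
      P = pow q n
      x = + n / 1
      0≤xη = 0≤* (0≤/ n 1) (<⇒≤ 0<η)
      q≤1 : q ≤ 1ℚ
      q≤1 = ≤-trans (subst (_≤ q + η) (+-identityʳ q) (+-monoʳ-≤ q (<⇒≤ 0<η))) q+η≤1
      step : q * (1ℚ + (x + 1ℚ) * η) ≤ 1ℚ + x * η
      step = begin
        q * (1ℚ + (x + 1ℚ) * η)            ≡⟨ solve 3 (λ q x η → q :* (con 1ℚ :+ (x :+ con 1ℚ) :* η) := q :+ q :* η :+ q :* (x :* η)) refl q x η ⟩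
        q + q * η + q * (x * η)            ≤⟨ +-mono-≤ (+-monoʳ-≤ q (*-monoˡ (<⇒≤ 0<η) q≤1)) (*-monoˡ 0≤xη q≤1) ⟩
        q + 1ℚ * η + 1ℚ * (x * η)          ≡⟨ cong₂ _+_ (cong (λ t → q + t) (*-identityˡ η)) (*-identityˡ (x * η)) ⟩
        q + η + x * η                      ≤⟨ +-monoˡ-≤ (x * η) q+η≤1 ⟩
        1ℚ + x * η                         ∎

    pow-small : ∀ ε → 0ℚ < ε → ∃ λ N → pow q N ≤ ε
    pow-small ε 0<ε with recip 0<ε
    ... | ε⁻¹ , 0<ε⁻¹ , eq with archimedean (ε⁻¹ * B)
    ... | N , h = N , subst₂ _≤_
      (trans (*-assoc P ε⁻¹ ε) (trans (cong (P *_) eq) (*-identityʳ P))) (*-identityˡ ε)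
      (*-monoˡ (<⇒≤ 0<ε) (≤-trans (*-monoʳ (0≤pow N) big) (bernoulli N)))
      where
      P = pow q N
      big : ε⁻¹ ≤ 1ℚ + (+ N / 1) * η
      big = ≤-trans
        (subst (_≤ (+ N / 1) * η) (trans (*-assoc ε⁻¹ B η) (trans (cong (ε⁻¹ *_) Bη≡1) (*-identityʳ ε⁻¹)))
          (*-monoˡ (<⇒≤ 0<η) h))
        (subst (_≤ 1ℚ + (+ N / 1) * η) (+-identityˡ _) (+-monoˡ-≤ ((+ N / 1) * η) 0≤1))

    1+qB≤B : 1ℚ + q * B ≤ B
    1+qB≤B = subst₂ _≤_ (trans (*-distribˡ-+ B η q) (cong₂ _+_ Bη≡1 (*-comm B q))) (*-identityʳ B)
      (*-monoʳ (<⇒≤ 0<B) (subst (_≤ 1ℚ) (+-comm q η) q+η≤1))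

    partialSum-bound : ∀ {a w} → (∀ k → ∣ a k ∣ ≤ 1ℚ) → ∣ w ∣ ≤ q → ∀ n → ∣ partialSum a n w ∣ ≤ B
    partialSum-bound a≤1 w≤q zero = <⇒≤ 0<B
    partialSum-bound {a} {w} a≤1 w≤q (suc n) = ≤-trans (∣p+q∣≤∣p∣+∣q∣ (a 0) (w * P))
      (≤-trans (+-mono-≤ (a≤1 0) (subst (_≤ q * B) (sym (∣p*q∣≡∣p∣*∣q∣ w P))
        (*-mono (0≤∣p∣ w) (<⇒≤ 0<B) w≤q (partialSum-bound (λ k → a≤1 (suc k)) w≤q n)))) 1+qB≤B)
      where P = partialSum (λ k → a (suc k)) n w

    partialSum-lipschitz : ∀ {a v w} → (∀ k → ∣ a k ∣ ≤ 1ℚ) → ∣ v ∣ ≤ q → ∣ w ∣ ≤ q → ∀ n →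
      ∣ partialSum a n v - partialSum a n w ∣ ≤ (B * B) * ∣ v - w ∣
    partialSum-lipschitz {v = v} {w} a≤1 v≤q w≤q zero = 0≤* (0≤* (<⇒≤ 0<B) (<⇒≤ 0<B)) (0≤∣p∣ (v - w))
    partialSum-lipschitz {a} {v} {w} a≤1 v≤q w≤q (suc n) = begin
      ∣ (a 0 + v * P) - (a 0 + w * R) ∣  ≡⟨ cong ∣_∣ (solve 5 (λ x v w P R → (x :+ v :* P) :- (x :+ w :* R) := v :* P :- w :* R) refl (a 0) v w P R) ⟩
      ∣ v * P - w * R ∣                  ≤⟨ ∣*-*∣-≤ v≤q (partialSum-bound (λ k → a≤1 (suc k)) w≤q n) ⟩
      q * ∣ P - R ∣ + B * d              ≤⟨ +-monoˡ-≤ (B * d) (*-monoʳ 0≤q (partialSum-lipschitz (λ k → a≤1 (suc k)) v≤q w≤q n)) ⟩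
      q * ((B * B) * d) + B * d          ≡⟨ solve 3 (λ q B d → q :* ((B :* B) :* d) :+ B :* d := (B :* d) :* (con 1ℚ :+ q :* B)) refl q B d ⟩
      (B * d) * (1ℚ + q * B)             ≤⟨ *-monoʳ (0≤* (<⇒≤ 0<B) (0≤∣p∣ (v - w))) 1+qB≤B ⟩
      (B * d) * B                        ≡⟨ solve 2 (λ B d → (B :* d) :* B := (B :* B) :* d) refl B d ⟩
      (B * B) * d                        ∎
      where
      open ≤-Reasoning
      P = partialSum (λ k → a (suc k)) n v
      R = partialSum (λ k → a (suc k)) n w
      d = ∣ v - w ∣

    partialSum-tail : ∀ {a w} → (∀ k → ∣ a k ∣ ≤ 1ℚ) → ∣ w ∣ ≤ q → ∀ n j →
      ∣ partialSum a (n ℕ.+ j) w - partialSum a n w ∣ ≤ pow q n * B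
    partialSum-tail {a} {w} a≤1 w≤q zero j = subst₂ _≤_
      (cong ∣_∣ (sym (+-identityʳ (partialSum a j w)))) (sym (*-identityˡ B)) (partialSum-bound a≤1 w≤q j)
    partialSum-tail {a} {w} a≤1 w≤q (suc n) j = begin
      ∣ (a 0 + w * P) - (a 0 + w * R) ∣  ≡⟨ cong ∣_∣ (solve 4 (λ x w P R → (x :+ w :* P) :- (x :+ w :* R) := w :* (P :- R)) refl (a 0) w P R) ⟩
      ∣ w * (P - R) ∣                    ≡⟨ ∣p*q∣≡∣p∣*∣q∣ w (P - R) ⟩
      ∣ w ∣ * ∣ P - R ∣                  ≤⟨ *-mono (0≤∣p∣ w) (0≤* (0≤pow n) (<⇒≤ 0<B)) w≤q (partialSum-tail (λ k → a≤1 (suc k)) w≤q n j) ⟩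
      q * (pow q n * B)                  ≡⟨ sym (*-assoc q (pow q n) B) ⟩
      (q * pow q n) * B                  ∎
      where
      open ≤-Reasoning
      P = partialSum (λ k → a (suc k)) (n ℕ.+ j) w
      R = partialSum (λ k → a (suc k)) n w

    partialSum-cauchy : ∀ a (w : ℕ → ℚ) → (∀ k → ∣ a k ∣ ≤ 1ℚ) →
      (∃ λ N → ∀ n → N ℕ.≤ n → ∣ w n ∣ ≤ q) → Cauchy w →
      Cauchy (λ n → partialSum a n (w n))
    partialSum-cauchy a w a≤1 (M , w≤q) s ε 0<ε = M ℕ.⊔ (K ℕ.⊔ N) , bound
      where
      open ≤-Reasoning
      ε₄ = ε * ½ * ½
      0<ε₄ = 0<* (0<* 0<ε 0<½) 0<½
      K = proj₁ (pow-small (ε₄ * η) (0<* 0<ε₄ 0<η))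
      lip = small-* (B * B) (0<* 0<B 0<B) s (ε * ½) (0<* 0<ε 0<½)
      N = proj₁ lip
      tail≤ : pow q K * B ≤ ε₄
      tail≤ = subst (pow q K * B ≤_)
        (trans (*-assoc ε₄ η B) (trans (cong (ε₄ *_) (trans (*-comm η B) Bη≡1)) (*-identityʳ ε₄)))
        (*-monoˡ (<⇒≤ 0<B) (proj₂ (pow-small (ε₄ * η) (0<* 0<ε₄ 0<η))))
      tail : ∀ n → M ℕ.≤ n → K ℕ.≤ n → ∣ partialSum a n (w n) - partialSum a K (w n) ∣ ≤ ε₄
      tail n M≤n K≤n = ≤-trans
        (subst (λ t → ∣ partialSum a t (w n) - partialSum a K (w n) ∣ ≤ pow q K * B) (ℕ.m+[n∸m]≡n K≤n)
          (partialSum-tail a≤1 (w≤q n M≤n) K (n ℕ.∸ K))) tail≤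
      M≤ : ∀ {n} → M ℕ.⊔ (K ℕ.⊔ N) ℕ.≤ n → M ℕ.≤ n
      M≤ = ℕ.m⊔n≤o⇒m≤o M (K ℕ.⊔ N)
      K≤ : ∀ {n} → M ℕ.⊔ (K ℕ.⊔ N) ℕ.≤ n → K ℕ.≤ n
      K≤ p = ℕ.m⊔n≤o⇒m≤o K N (ℕ.m⊔n≤o⇒n≤o M (K ℕ.⊔ N) p)
      N≤ : ∀ {n} → M ℕ.⊔ (K ℕ.⊔ N) ℕ.≤ n → N ℕ.≤ n
      N≤ p = ℕ.m⊔n≤o⇒n≤o K N (ℕ.m⊔n≤o⇒n≤o M (K ℕ.⊔ N) p)
      bound : ∀ m n → M ℕ.⊔ (K ℕ.⊔ N) ℕ.≤ m → M ℕ.⊔ (K ℕ.⊔ N) ℕ.≤ n →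
              ∣ partialSum a m (w m) - partialSum a n (w n) ∣ ≤ ε
      bound m n p r = begin
        ∣ A - D ∣                              ≤⟨ triangle A E D ⟩
        ∣ A - E ∣ + ∣ E - D ∣                  ≤⟨ +-monoʳ-≤ ∣ A - E ∣ (triangle E F D) ⟩
        ∣ A - E ∣ + (∣ E - F ∣ + ∣ F - D ∣)    ≤⟨ +-mono-≤ (tail m (M≤ p) (K≤ p)) (+-mono-≤
          (≤-trans (partialSum-lipschitz a≤1 (w≤q m (M≤ p)) (w≤q n (M≤ r)) K) (proj₂ lip m n (N≤ p) (N≤ r)))
          (subst (_≤ ε₄) (∣-∣-comm D F) (tail n (M≤ r) (K≤ r)))) ⟩
        ε₄ + (ε * ½ + ε₄)                      ≡⟨ solve 2 (λ x y → y :+ (x :+ y) := x :+ (y :+ y)) refl (ε * ½) ε₄ ⟩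
        ε * ½ + (ε₄ + ε₄)                      ≡⟨ cong (λ t → ε * ½ + t) (halves (ε * ½)) ⟩
        ε * ½ + ε * ½                          ≡⟨ halves ε ⟩
        ε                                      ∎
        where
        A = partialSum a m (w m)
        D = partialSum a n (w n)
        E = partialSum a K (w m)
        F = partialSum a K (w n)

  -- Leibniz's estimate, for nonnegative decreasing a.
  module Alternating where

    private
      step : ∀ x y → x + - 1ℚ * y ≡ x - y
      step = solve 2 (λ x y → x :+ con (- 1ℚ) :* y := x :- y) refl

    partialSum-range : ∀ {a} → (∀ k → 0ℚ ≤ a k) → (∀ k → a (suc k) ≤ a k) → ∀ n →
      0ℚ ≤ partialSum a n (- 1ℚ) × partialSum a n (- 1ℚ) ≤ a 0
    partialSum-range 0≤a dec zero = ≤-refl , 0≤a 0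
    partialSum-range {a} 0≤a dec (suc n) with partialSum-range (λ k → 0≤a (suc k)) (λ k → dec (suc k)) n
    ... | 0≤P , P≤a = subst (0ℚ ≤_) (sym (step (a 0) P))
            (subst (_≤ a 0 - P) (+-inverseʳ P) (+-monoˡ-≤ (- P) (≤-trans P≤a (dec 0))))
        , subst₂ _≤_ (sym (step (a 0) P)) (+-identityʳ (a 0)) (+-monoʳ-≤ (a 0) (neg-antimono-≤ 0≤P))
      where P = partialSum (λ k → a (suc k)) n (- 1ℚ)

    partialSum-tail : ∀ {a} → (∀ k → 0ℚ ≤ a k) → (∀ k → a (suc k) ≤ a k) → ∀ n j →
      ∣ partialSum a (n ℕ.+ j) (- 1ℚ) - partialSum a n (- 1ℚ) ∣ ≤ a n
    partialSum-tail {a} 0≤a dec zero j with partialSum-range 0≤a dec j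
    ... | 0≤P , P≤a = subst (_≤ a 0)
      (trans (sym (0≤p⇒∣p∣≡p 0≤P)) (cong ∣_∣ (sym (+-identityʳ (partialSum a j (- 1ℚ)))))) P≤a
    partialSum-tail {a} 0≤a dec (suc n) j = subst (_≤ a (suc n))
      (sym (trans (cong ∣_∣ (solve 3 (λ x P R → (x :+ con (- 1ℚ) :* P) :- (x :+ con (- 1ℚ) :* R) := R :- P) refl (a 0) P R))
        (∣-∣-comm R P)))
      (partialSum-tail (λ k → 0≤a (suc k)) (λ k → dec (suc k)) n j)
      where
      P = partialSum (λ k → a (suc k)) (n ℕ.+ j) (- 1ℚ)
      R = partialSum (λ k → a (suc k)) n (- 1ℚ)

    partialSum-cauchy : ∀ a → (∀ k → 0ℚ ≤ a k) → (∀ k → a (suc k) ≤ a k) →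
      (∀ ε → 0ℚ < ε → ∃ λ N → a N ≤ ε) → Cauchy (λ n → partialSum a n (- 1ℚ))
    partialSum-cauchy a 0≤a dec a→0 ε 0<ε with a→0 (ε * ½) (0<* 0<ε 0<½)
    ... | N , aN≤ = N , λ m n N≤m N≤n → subst (∣ P m - P n ∣ ≤_) (halves ε)
      (≤-trans (triangle (P m) (P N) (P n))
        (+-mono-≤ (tail m N≤m) (subst (_≤ ε * ½) (∣-∣-comm (P n) (P N)) (tail n N≤n))))
      where
      P : ℕ → ℚ
      P n = partialSum a n (- 1ℚ)
      tail : ∀ n → N ℕ.≤ n → ∣ P n - P N ∣ ≤ ε * ½
      tail n N≤n = ≤-trans (subst (λ t → ∣ P t - P N ∣ ≤ a N) (ℕ.m+[n∸m]≡n N≤n)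
        (partialSum-tail 0≤a dec N (n ℕ.∸ N))) aN≤

  0≤odd : ∀ k → 0ℚ ≤ odd-reciprocal k
  0≤odd k = 0≤/ 1 (suc (2 ℕ.* k))

  odd-decreasing : ∀ k → odd-reciprocal (suc k) ≤ odd-reciprocal k
  odd-decreasing k = /-≤ 1 (suc (2 ℕ.* suc k)) 1 (suc (2 ℕ.* k))
    (ℕ.*-monoʳ-≤ 1 (ℕ.s≤s (ℕ.*-monoʳ-≤ 2 (ℕ.n≤1+n k))))

  odd≤1 : ∀ k → ∣ odd-reciprocal k ∣ ≤ 1ℚ
  odd≤1 k = subst (_≤ 1ℚ) (sym (0≤p⇒∣p∣≡p (0≤odd k)))
    (/-≤ 1 (suc (2 ℕ.* k)) 1 1 (ℕ.*-monoʳ-≤ 1 (ℕ.s≤s ℕ.z≤n)))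

  odd-small : ∀ ε → 0ℚ < ε → ∃ λ N → odd-reciprocal N ≤ ε
  odd-small ε 0<ε with 1/n-small ε 0<ε
  ... | N , h = N , h (2 ℕ.* N) (ℕ.m≤m+n N (N ℕ.+ 0))

  const-cauchy : ∀ p → Cauchy (λ _ → p)
  const-cauchy p ε 0<ε = 0 , λ _ _ _ _ → ≤-trans (≤-reflexive (cong ∣_∣ (+-inverseʳ p))) (<⇒≤ 0<ε)

  +-cauchy : ∀ f g → Cauchy f → Cauchy g → Cauchy (λ n → f n + g n)
  +-cauchy f g s t = small-≤ 0 (λ m n _ _ → subst (λ x → ∣ x ∣ ≤ ∣ f m - f n ∣ + ∣ g m - g n ∣)
    (solve 4 (λ p q r s → (p :- q) :+ (r :- s) := (p :+ r) :- (q :+ s)) refl (f m) (f n) (g m) (g n))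
    (∣p+q∣≤∣p∣+∣q∣ (f m - f n) (g m - g n))) (small-+ s t)

  neg-cauchy : ∀ f → Cauchy f → Cauchy (λ n → - f n)
  neg-cauchy f = small-≤ 0 (λ m n _ _ → ≤-reflexive (trans
    (cong ∣_∣ (solve 2 (λ p q → (:- p) :- (:- q) := :- (p :- q)) refl (f m) (f n)))
    (∣-p∣≡∣p∣ (f m - f n))))

  abs-cauchy : ∀ f → Cauchy f → Cauchy (λ n → ∣ f n ∣)
  abs-cauchy f = small-≤ 0 (λ m n _ _ → ∣∣-∣∣-≤ (f m) (f n))

  ⊓-cauchy : ∀ f g → Cauchy f → Cauchy g → Cauchy (λ n → f n ⊓ g n)
  ⊓-cauchy f g s t = small-≤ 0 (λ m n _ _ → ∣⊓-⊓∣-≤ (f m) (g m) (f n) (g n)) (small-+ s t)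

  *-cauchy : ∀ f g → Cauchy f → Cauchy g → Cauchy (λ n → f n * g n)
  *-cauchy f g s t =
    let K , 0<K , M , f≤K = bounded f s
        L , 0<L , N , g≤L = bounded g t
    in small-≤
    {λ m n → ∣ f m * g m - f n * g n ∣} {λ m n → K * ∣ g m - g n ∣ + L * ∣ f m - f n ∣} (M ℕ.⊔ N)
    (λ m n p q → ∣*-*∣-≤ {f m} {f n} {g m} {g n} {K} {L} (f≤K m (ℕ.m⊔n≤o⇒m≤o M N p)) (g≤L n (ℕ.m⊔n≤o⇒n≤o M N q)))
    (small-+ {λ m n → K * ∣ g m - g n ∣} {λ m n → L * ∣ f m - f n ∣}
      (small-* {λ m n → ∣ g m - g n ∣} K 0<K t) (small-* {λ m n → ∣ f m - f n ∣} L 0<L s))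

  inverse-cauchy : ∀ f {δ N} → 0ℚ < δ → (∀ n → N ℕ.≤ n → δ ≤ f n) →
    Cauchy f → Cauchy (λ n → inverse (f n))
  inverse-cauchy f {δ} {N} 0<δ δ≤f s = let δ⁻¹ , 0<δ⁻¹ , eq = recip 0<δ in small-≤
    {λ m n → ∣ inverse (f m) - inverse (f n) ∣} {λ m n → (δ⁻¹ * δ⁻¹) * ∣ f m - f n ∣} N
    (λ m n p q → ∣inverse-inverse∣-≤ {δ} {δ⁻¹} {f m} {f n} 0<δ 0<δ⁻¹ eq (δ≤f m p) (δ≤f n q))
    (small-* {λ m n → ∣ f m - f n ∣} (δ⁻¹ * δ⁻¹) (0<* 0<δ⁻¹ 0<δ⁻¹) s)

  series-cauchy : ∀ a w {ε N} → (∀ k → ∣ a k ∣ ≤ 1ℚ) → 0ℚ < ε →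
    (∀ n → N ℕ.≤ n → ∣ w n ∣ + ε ≤ 1ℚ) → Cauchy w → Cauchy (λ n → partialSum a n (w n))
  series-cauchy a w {ε} {N} a≤1 0<ε w<1 s = let B , 0<B , Bε≡1 = recip 0<ε in Geometric.partialSum-cauchy 0≤q 0<ε
      (≤-reflexive (solve 2 (λ o e → o :- e :+ e := o) refl 1ℚ ε)) 0<B Bε≡1 a w a≤1 (N , w≤q) s
    where
    w≤q : ∀ n → N ℕ.≤ n → ∣ w n ∣ ≤ 1ℚ - ε
    w≤q n N≤n = subst (_≤ 1ℚ - ε) (solve 2 (λ x e → x :+ e :- e := x) refl ∣ w n ∣ ε)
      (+-monoˡ-≤ (- ε) (w<1 n N≤n))
    0≤q : 0ℚ ≤ 1ℚ - ε
    0≤q = ≤-trans (0≤∣p∣ (w N)) (w≤q N ℕ.≤-refl)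

  square-<1 : ∀ z {ε} → 0ℚ < ε → ∣ z ∣ + ε ≤ 1ℚ → ∣ z * z ∣ + ε ≤ 1ℚ
  square-<1 z {ε} 0<ε h = ≤-trans (+-monoˡ-≤ ε (subst₂ _≤_ (sym (∣p*q∣≡∣p∣*∣q∣ z z)) (*-identityˡ ∣ z ∣)
    (*-monoˡ (0≤∣p∣ z) ∣z∣≤1))) h
    where
    ∣z∣≤1 : ∣ z ∣ ≤ 1ℚ
    ∣z∣≤1 = ≤-trans (subst (_≤ ∣ z ∣ + ε) (+-identityʳ ∣ z ∣) (+-monoʳ-≤ ∣ z ∣ (<⇒≤ 0<ε))) h

  0<⊓ : ∀ {p q} → 0ℚ < p → 0ℚ < q → 0ℚ < p ⊓ q
  0<⊓ {p} {q} 0<p 0<q with ⊓-sel p q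
  ... | inj₁ eq = subst (0ℚ <_) (sym eq) 0<p
  ... | inj₂ eq = subst (0ℚ <_) (sym eq) 0<q

  -- 1 − z = 2/(y+1) and 1 + z = 2y/(y+1) for z = (y−1)/(y+1).
  möbius-<1 : ∀ y {δ K L} → 0ℚ < δ → δ ≤ y → y ≤ K → 0ℚ < L → L * (K + 1ℚ) ≡ 1ℚ →
    ∣ (y + - 1ℚ) * inverse (y + 1ℚ) ∣ + ((L + L) ⊓ ((L + L) * δ)) ≤ 1ℚ
  möbius-<1 y {δ} {K} {L} 0<δ δ≤y y≤K 0<L eq = subst (∣ z ∣ + e ≤_)
      (solve 2 (λ o e → o :- e :+ e := o) refl 1ℚ e)
      (+-monoˡ-≤ e (abs-≤ upper lower))
    where
    open ≤-Reasoning
    e = (L + L) ⊓ ((L + L) * δ)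
    i = inverse (y + 1ℚ)
    z = (y + - 1ℚ) * i
    0<y = <-≤-trans 0<δ δ≤y
    0<y+1 : 0ℚ < y + 1ℚ
    0<y+1 = +-mono-<-≤ 0<y 0≤1
    iy : i * (y + 1ℚ) ≡ 1ℚ
    iy = inverseˡ 0<y+1
    L≤i : L ≤ i
    L≤i = subst₂ _≤_
      (trans (solve 3 (λ i L y → L :* (i :* y) := (L :* i) :* y) refl i L (y + 1ℚ))
        (trans (*-assoc L i (y + 1ℚ)) (trans (cong (L *_) iy) (*-identityʳ L))))
      (trans (solve 3 (λ i L k → (L :* i) :* k := i :* (L :* k)) refl i L (K + 1ℚ))
        (trans (cong (i *_) eq) (*-identityʳ i)))
      (≤-trans (≤-reflexive (sym (*-assoc L i (y + 1ℚ)))) (*-monoʳ (0≤* (<⇒≤ 0<L) (0≤inverse 0<y+1)) (+-monoˡ-≤ 1ℚ y≤K)))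
    1-z : i * (y + 1ℚ) - z ≡ i + i
    1-z = solve 2 (λ i y → i :* (y :+ con 1ℚ) :- (y :+ con (- 1ℚ)) :* i := i :+ i) refl i y
    1+z : i * (y + 1ℚ) + z ≡ (i + i) * y
    1+z = solve 2 (λ i y → i :* (y :+ con 1ℚ) :+ (y :+ con (- 1ℚ)) :* i := (i :+ i) :* y) refl i y
    2L≤2i = +-mono-≤ L≤i L≤i
    upper : z ≤ 1ℚ - e
    upper = begin
      z                  ≡⟨ solve 2 (λ o z → z := o :- (o :- z)) refl 1ℚ z ⟩
      1ℚ - (1ℚ - z)      ≡⟨ cong (λ t → 1ℚ - t) (trans (cong (_- z) (sym iy)) 1-z) ⟩
      1ℚ - (i + i)       ≤⟨ +-monoʳ-≤ 1ℚ (neg-antimono-≤ (≤-trans (p⊓q≤p (L + L) ((L + L) * δ)) 2L≤2i)) ⟩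
      1ℚ - e             ∎
    lower : - z ≤ 1ℚ - e
    lower = begin
      - z                ≡⟨ solve 2 (λ o z → :- z := o :- (o :+ z)) refl 1ℚ z ⟩
      1ℚ - (1ℚ + z)      ≡⟨ cong (λ t → 1ℚ - t) (trans (cong (_+ z) (sym iy)) 1+z) ⟩
      1ℚ - (i + i) * y   ≤⟨ +-monoʳ-≤ 1ℚ (neg-antimono-≤ (≤-trans (p⊓q≤q (L + L) ((L + L) * δ))
                             (*-mono (<⇒≤ (+-mono-< 0<L 0<L)) (<⇒≤ 0<y) 2L≤2i δ≤y))) ⟩
      1ℚ - e             ∎

record ℝ : Set where
  constructor mkℝ
  field
    seq    : ℕ → ℚ
    cauchy : Cauchy seq

open ℝ public

infix  4 _≤_ _<_
infixl 6 _+_ _-_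
infixl 7 _*_ _⊓_ _÷_[_]
infix  8 -_

_≤_ : ℝ → ℝ → Set
x ≤ y = ∀ ε → 0ℚ ℚ.< ε → ∃ λ N → ∀ n → N ℕ.≤ n → seq x n ℚ.≤ seq y n ℚ.+ ε

_<_ : ℝ → ℝ → Set
x < y = ∃ λ ε → 0ℚ ℚ.< ε × ∃ λ N → ∀ n → N ℕ.≤ n → seq x n ℚ.+ ε ℚ.≤ seq y n

fromℚ : ℚ → ℝ
fromℚ p = mkℝ (λ _ → p) (Estimates.const-cauchy p)

fromℕ : ℕ → ℝ
fromℕ n = fromℚ (+ n / 1)

_+_ : ℝ → ℝ → ℝ
x + y = mkℝ (λ n → seq x n ℚ.+ seq y n) (Estimates.+-cauchy (seq x) (seq y) (cauchy x) (cauchy y))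

-_ : ℝ → ℝ
- x = mkℝ (λ n → ℚ.- seq x n) (Estimates.neg-cauchy (seq x) (cauchy x))

_-_ : ℝ → ℝ → ℝ
x - y = x + (- y)

_*_ : ℝ → ℝ → ℝ
x * y = mkℝ (λ n → seq x n ℚ.* seq y n) (Estimates.*-cauchy (seq x) (seq y) (cauchy x) (cauchy y))

_⊓_ : ℝ → ℝ → ℝ
x ⊓ y = mkℝ (λ n → seq x n ℚ.⊓ seq y n) (Estimates.⊓-cauchy (seq x) (seq y) (cauchy x) (cauchy y))

∣_∣ : ℝ → ℝ
∣ x ∣ = mkℝ (λ n → ℚ.∣ seq x n ∣) (Estimates.abs-cauchy (seq x) (cauchy x))

_÷_[_] : (x y : ℝ) → fromℕ 0 < y → ℝ
x ÷ y [ δ , 0<δ , N , h ] = x * mkℝ (λ n → inverse (seq y n))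
  (Estimates.inverse-cauchy (seq y) 0<δ (λ n N≤n → subst (ℚ._≤ seq y n) (ℚ.+-identityˡ δ) (h n N≤n)) (cauchy y))

+-positive : ∀ x y → fromℕ 0 < x → fromℕ 0 < y → fromℕ 0 < x + y
+-positive x y (δ , 0<δ , M , h) (ε , 0<ε , N , k) =
  δ ℚ.+ ε , ℚ.+-mono-< 0<δ 0<ε , M ℕ.⊔ N , λ n p →
    subst (ℚ._≤ seq x n ℚ.+ seq y n) (trans (cong₂ ℚ._+_ (ℚ.+-identityˡ δ) (ℚ.+-identityˡ ε)) (sym (ℚ.+-identityˡ _)))
      (ℚ.+-mono-≤ (h n (ℕ.m⊔n≤o⇒m≤o M N p)) (k n (ℕ.m⊔n≤o⇒n≤o M N p)))

*-positive : ∀ x y → fromℕ 0 < x → fromℕ 0 < y → fromℕ 0 < x * y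
*-positive x y (δ , 0<δ , M , h) (ε , 0<ε , N , k) =
  δ ℚ.* ε , 0<* 0<δ 0<ε , M ℕ.⊔ N , λ n p →
    subst (ℚ._≤ seq x n ℚ.* seq y n) (sym (ℚ.+-identityˡ _))
      (*-mono (ℚ.<⇒≤ 0<δ) (0≤y n (ℕ.m⊔n≤o⇒n≤o M N p))
        (subst (ℚ._≤ seq x n) (ℚ.+-identityˡ δ) (h n (ℕ.m⊔n≤o⇒m≤o M N p)))
        (subst (ℚ._≤ seq y n) (ℚ.+-identityˡ ε) (k n (ℕ.m⊔n≤o⇒n≤o M N p))))
  where
  open Estimates
  0≤y : ∀ n → N ℕ.≤ n → 0ℚ ℚ.≤ seq y n
  0≤y n N≤n = ℚ.≤-trans (ℚ.<⇒≤ 0<ε) (subst (ℚ._≤ seq y n) (ℚ.+-identityˡ ε) (k n N≤n))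

fromℕ-positive : ∀ n → fromℕ 0 < fromℕ (suc n)
fromℕ-positive n = 1ℚ , ℚ.positive⁻¹ 1ℚ , 0 , λ _ _ →
  subst (ℚ._≤ + suc n / 1) (sym (ℚ.+-identityˡ 1ℚ))
    (Estimates./-≤ 1 1 (suc n) 1 (ℕ.s≤s ℕ.z≤n))

√ : ℕ → ℝ
√ m = mkℝ (√-approx m) (Estimates.√-cauchy m)

1+√-positive : ∀ m → fromℕ 0 < fromℕ 1 + √ m
1+√-positive m = 1ℚ , ℚ.positive⁻¹ 1ℚ , 0 , λ n _ →
  subst₂ ℚ._≤_ (ℚ.+-comm 1ℚ 0ℚ) refl
    (ℚ.+-monoʳ-≤ 1ℚ (Estimates.0≤/ ⌊√ m ℕ.* (suc n ℕ.* suc n) ⌋ (suc n)))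

-- Leibniz: π = 4 · Σ_k (−1)^k / (2k+1).
π : ℝ
π = fromℕ 4 * mkℝ (λ n → partialSum odd-reciprocal n (ℚ.- 1ℚ)) (Alternating.partialSum-cauchy odd-reciprocal 0≤odd odd-decreasing odd-small)
  where open Estimates

-- artanh z = Σ_k z^(2k+1) / (2k+1).
artanh : (z : ℝ) → ∣ z ∣ < fromℕ 1 → ℝ
artanh z (ε , 0<ε , N , h) = z * mkℝ (λ n → partialSum odd-reciprocal n (seq z n ℚ.* seq z n))
  (series-cauchy odd-reciprocal (λ n → seq z n ℚ.* seq z n) odd≤1 0<ε (λ n N≤n → square-<1 (seq z n) 0<ε (h n N≤n)) (cauchy (z * z)))
  where open Estimates

möbius-bound : ∀ y (y>0 : fromℕ 0 < y) →
  ∣ (y - fromℕ 1) ÷ (y + fromℕ 1) [ +-positive y (fromℕ 1) y>0 (fromℕ-positive 0) ] ∣ < fromℕ 1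
möbius-bound y (δ , 0<δ , N , h) =
  let K , 0<K , M , y≤K = bounded (seq y) (cauchy y)
      L , 0<L , eq = recip (ℚ.+-mono-< 0<K (ℚ.positive⁻¹ 1ℚ))
  in (L ℚ.+ L) ℚ.⊓ ((L ℚ.+ L) ℚ.* δ)
  , 0<⊓ (ℚ.+-mono-< 0<L 0<L) (0<* (ℚ.+-mono-< 0<L 0<L) 0<δ)
  , N ℕ.⊔ M , λ n p → möbius-<1 (seq y n) 0<δ
      (subst (ℚ._≤ seq y n) (ℚ.+-identityˡ δ) (h n (ℕ.m⊔n≤o⇒m≤o N M p)))
      (ℚ.≤-trans (p≤∣p∣ (seq y n)) (y≤K n (ℕ.m⊔n≤o⇒n≤o N M p))) 0<L eq
  where open Estimates

-- ln y = 2 artanh ((y − 1) / (y + 1)), valid for every y > 0.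
ln : (y : ℝ) → fromℕ 0 < y → ℝ
ln y y>0 = fromℕ 2 * artanh
  ((y - fromℕ 1) ÷ (y + fromℕ 1) [ +-positive y (fromℕ 1) y>0 (fromℕ-positive 0) ])
  (möbius-bound y y>0)

3x+4-positive : ∀ x → fromℕ 0 < x → fromℕ 0 < fromℕ 3 * x + fromℕ 4
3x+4-positive x x>0 = +-positive (fromℕ 3 * x) (fromℕ 4)
  (*-positive (fromℕ 3) x (fromℕ-positive 2) x>0) (fromℕ-positive 3)

π-positive : fromℕ 0 < π
π-positive = + 8 / 3 , ℚ.positive⁻¹ (+ 8 / 3) , 1 , bound
  where
  open Estimates
  bound : ∀ n → 1 ℕ.≤ n → 0ℚ ℚ.+ + 8 / 3 ℚ.≤ seq π n
  bound (suc n) _ = ℚ.*-monoˡ-≤-nonNeg (+ 4 / 1) (ℚ.+-monoʳ-≤ 1ℚ (ℚ.*-monoˡ-≤-nonPos (ℚ.- 1ℚ)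
    (proj₂ (Alternating.partialSum-range (λ k → 0≤odd (suc k)) (λ k → odd-decreasing (suc k)) n))))

∑ : ∀ {n} → (Fin n → ℝ) → ℝ
∑ = Vector.foldr _+_ (fromℕ 0)

-- (i , j , k , l), each coordinate counted from 0.
Vertex : ℕ → Set
Vertex r = Fin r × Fin r × Fin 4 × Fin 2

data Edge (r : ℕ) : Set where
  e₀  : Fin (ℕ.pred r) → Fin r → Fin 4 → Edge r
  e₁  : Fin r → Fin (ℕ.pred r) → Fin 4 → Edge r
  e₀₁ : Fin r → Fin r → Fin 4 → Fin 4 → Edge r

this next : ∀ {r} → Fin (ℕ.pred r) → Fin r
this {suc r} i = inject₁ i
next {suc r} i = Fin.suc i

endpoints : ∀ {r} → Edge r → Vertex r × Vertex r
endpoints (e₀ i j k)      = (this i , j , k , Fin.zero) , (next i , j , k , Fin.zero)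
endpoints (e₁ i j k)      = (i , this j , k , Fin.suc Fin.zero) , (i , next j , k , Fin.suc Fin.zero)
endpoints (e₀₁ i j k₀ k₁) = (i , j , k₀ , Fin.zero) , (i , j , k₁ , Fin.suc Fin.zero)

∑-vertices : ∀ {r} → (Vertex r → ℝ) → ℝ
∑-vertices f = ∑ λ i → ∑ λ j → ∑ λ k → ∑ λ l → f (i , j , k , l)

∑-edges : ∀ {r} → (Edge r → ℝ) → ℝ
∑-edges f = (∑ λ i → ∑ λ j → ∑ λ k → f (e₀ i j k))
          + (∑ λ i → ∑ λ j → ∑ λ k → f (e₁ i j k))
          + (∑ λ i → ∑ λ j → ∑ λ k₀ → ∑ λ k₁ → f (e₀₁ i j k₀ k₁))

spin : Sign → ℝ
spin Sign.+ = fromℕ 1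
spin Sign.- = - fromℕ 1

functions : ∀ {A : Set} → List A → ∀ n → List (Fin n → A)
functions xs zero    = (λ ()) ∷ []
functions xs (suc n) = List.cartesianProductWith Vector._∷_ xs (functions xs n)

-- All of {−1,1}^V.
configurations : ∀ r → List (Vertex r → Sign)
configurations r = List.map (λ S (i , j , k , l) → S i j k l)
  (functions (functions (functions (functions (Sign.+ ∷ Sign.- ∷ []) 2) 4) r) r)

energy : ∀ {r} → (Edge r → ℝ) → (Vertex r → ℝ) → (Vertex r → Sign) → ℝ
energy c d S =
    ∑-edges (λ e → c e * spin (S (proj₁ (endpoints e))) * spin (S (proj₂ (endpoints e))))
  + ∑-vertices (λ u → d u * spin (S u))

-- The fold starts from the energy of one of the configurations, since the
-- minimum of an empty list does not exist.
H* : ∀ r → (Edge r → ℝ) → (Vertex r → ℝ) → ℝ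
H* r c d = List.foldr _⊓_ (energy c d (λ _ → Sign.+)) (List.map (energy c d) (configurations r))

{-# OPTIONS --safe #-}
-- The constant is C = 4/5, for which C/(3C+4) = 1/8.  Fix a configuration S and
-- sign vectors χ; averaging the energy over S and S·χ deletes exactly the terms
-- on which χ takes the value −1, so H* is at most the remaining part of the
-- energy of S.  In this way H* is at most minus the sum of the absolute values
-- over each of eight classes that partition all terms: the edges E₀ and the
-- edges E₁ (unions of paths), for each k₀ the edges of E₀₁ at the vertices
-- (i,j,k₀,0) (unions of stars), and the fields d on each of the two colour
-- classes of the bipartite graph G_r.  Summing the eight bounds gives the
-- factor 1/8, and the crude estimates ln(1+√2) ≤ 4/3 and π ≥ 8/3 give
-- ln(1+√2)/π ≤ 1/2 < C.
-- Since all operations on reals act termwise on the approximating sequences,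
-- the inequality is proved over ℚ at each index separately.
module Submission where

open import Data.Bool.Base using (if_then_else_)
open import Data.Fin.Base using (Fin; zero; suc; inject₁)
import Data.Fin.Properties as Fin
open import Data.Fin.Patterns using (0F; 1F; 2F; 3F)
open import Data.Integer.Base using (+_)
open import Data.List.Base as List using (List; []; _∷_)
open import Data.List.Relation.Unary.Any as Any using (Any; here; there)
import Data.List.Relation.Unary.Any.Properties as Any
open import Data.Nat.Base as ℕ using (ℕ; NonZero)
import Data.Nat.Properties as ℕ
open import Data.Product using (Σ; ∃; _×_; _,_; proj₁; proj₂)
open import Data.Rational.Base as ℚ using (ℚ; 0ℚ; 1ℚ; ½; _/_)
import Data.Rational.Properties as ℚ
open import Data.Rational.Solver using (module +-*-Solver)
open import Data.Sign.Base as Sign using (Sign; opposite)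
import Data.Sign.Properties as Sign
open import Data.Sum.Base using (_⊎_; inj₁; inj₂; [_,_]′)
import Data.Vec.Functional as Vector
open import Function.Base using (_∘_; const)
open import Relation.Binary.PropositionalEquality
open import Relation.Nullary using (does; yes; no; contradiction)
open import Defs

open import Algebra.Properties.CommutativeMonoid.Sum ℚ.+-0-commutativeMonoid
  using (sum; sum-cong-≗; ∑-distrib-+)
open +-*-Solver using (solve; _:=_; _:+_; _:*_; :-_; con)

-- Finite sums

-- An additive functional on rational-valued functions. Additivity is all that averaging needs, so
-- the nested shape of the sums over the graph can be forgotten.
record Summation (A : Set) : Set where
  field
    apply      : (A → ℚ) → ℚ
    apply-cong : ∀ {f g} → f ≗ g → apply f ≡ apply g
    apply-+    : ∀ f g → apply (λ x → f x ℚ.+ g x) ≡ apply f ℚ.+ apply g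

open Summation

fin : ∀ k → Summation (Fin k)
fin k .apply      = sum
fin k .apply-cong = sum-cong-≗
fin k .apply-+    = ∑-distrib-+

infixr 5 _⊗_
_⊗_ : ∀ {A B} → Summation A → Summation B → Summation (A × B)
(P ⊗ Q) .apply f      = P .apply λ x → Q .apply λ y → f (x , y)
(P ⊗ Q) .apply-cong h = P .apply-cong λ x → Q .apply-cong λ y → h (x , y)
(P ⊗ Q) .apply-+ f g  = trans (P .apply-cong λ x → Q .apply-+ _ _) (P .apply-+ _ _)

image : ∀ {A B} → (A → B) → Summation A → Summation B
image h P .apply f      = P .apply (f ∘ h)
image h P .apply-cong e = P .apply-cong (e ∘ h)
image h P .apply-+ f g  = P .apply-+ _ _

infixl 4 _⊞_
_⊞_ : ∀ {A} → Summation A → Summation A → Summation A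
(P ⊞ Q) .apply f      = P .apply f ℚ.+ Q .apply f
(P ⊞ Q) .apply-cong h = cong₂ ℚ._+_ (P .apply-cong h) (Q .apply-cong h)
(P ⊞ Q) .apply-+ f g  = trans (cong₂ ℚ._+_ (P .apply-+ f g) (Q .apply-+ f g))
  (solve 4 (λ a b c d → (a :+ b) :+ (c :+ d) := (a :+ c) :+ (b :+ d)) refl
    (P .apply f) (P .apply g) (Q .apply f) (Q .apply g))

apply-0 : ∀ {A} (P : Summation A) → P .apply (λ _ → 0ℚ) ≡ 0ℚ
apply-0 P = begin
  z              ≡⟨ solve 1 (λ z → z := (z :+ z) :+ (:- z)) refl z ⟩
  z ℚ.+ z ℚ.- z  ≡⟨ cong (ℚ._- z) (sym (P .apply-+ _ _)) ⟩
  z ℚ.- z        ≡⟨ ℚ.+-inverseʳ z ⟩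
  0ℚ             ∎
  where
  open ≡-Reasoning
  z = P .apply (λ _ → 0ℚ)

apply-neg : ∀ {A} (P : Summation A) f → P .apply (ℚ.-_ ∘ f) ≡ ℚ.- P .apply f
apply-neg P f = begin
  y                ≡⟨ solve 2 (λ x y → y := (y :+ x) :+ (:- x)) refl x y ⟩
  y ℚ.+ x ℚ.- x    ≡⟨ cong (ℚ._- x) (sym (P .apply-+ _ _)) ⟩
  P .apply (λ t → ℚ.- f t ℚ.+ f t) ℚ.- x
                   ≡⟨ cong (ℚ._- x) (trans (P .apply-cong (ℚ.+-inverseˡ ∘ f)) (apply-0 P)) ⟩
  0ℚ ℚ.- x         ≡⟨ ℚ.+-identityˡ _ ⟩
  ℚ.- x            ∎
  where
  open ≡-Reasoning
  x = P .apply f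
  y = P .apply (ℚ.-_ ∘ f)

Term : ℕ → Set
Term r = Edge r ⊎ Vertex r

vertices : ∀ r → Summation (Vertex r)
vertices r = fin r ⊗ fin r ⊗ fin 4 ⊗ fin 2

edges : ∀ r → Summation (Edge r)
edges r = image (λ (i , j , k) → e₀ i j k) (fin (ℕ.pred r) ⊗ fin r ⊗ fin 4)
        ⊞ image (λ (i , j , k) → e₁ i j k) (fin r ⊗ fin (ℕ.pred r) ⊗ fin 4)
        ⊞ image (λ (i , j , k₀ , k₁) → e₀₁ i j k₀ k₁) (fin r ⊗ fin r ⊗ fin 4 ⊗ fin 4)

terms : ∀ r → Summation (Term r)
terms r = image inj₁ (edges r) ⊞ image inj₂ (vertices r)

seq-∑ : ∀ {k} (f : Fin k → ℝ) n → seq (∑ f) n ≡ sum (λ i → seq (f i) n)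
seq-∑ {ℕ.zero}  f n = refl
seq-∑ {ℕ.suc k} f n = cong (seq (f zero) n ℚ.+_) (seq-∑ (f ∘ suc) n)

seq-∑³ : ∀ {p q s} (f : Fin p → Fin q → Fin s → ℝ) n →
  seq (∑ λ i → ∑ λ j → ∑ λ k → f i j k) n ≡ sum λ i → sum λ j → sum λ k → seq (f i j k) n
seq-∑³ f n = trans (seq-∑ (λ i → ∑ λ j → ∑ λ k → f i j k) n) (sum-cong-≗ λ i →
  trans (seq-∑ (λ j → ∑ λ k → f i j k) n) (sum-cong-≗ λ j → seq-∑ (f i j) n))

seq-∑⁴ : ∀ {p q s t} (f : Fin p → Fin q → Fin s → Fin t → ℝ) n →
  seq (∑ λ i → ∑ λ j → ∑ λ k → ∑ λ l → f i j k l) n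
    ≡ sum λ i → sum λ j → sum λ k → sum λ l → seq (f i j k l) n
seq-∑⁴ f n = trans (seq-∑ (λ i → ∑ λ j → ∑ λ k → ∑ λ l → f i j k l) n)
  (sum-cong-≗ λ i → seq-∑³ (f i) n)

seq-∑-vertices : ∀ {r} (f : Vertex r → ℝ) n →
  seq (∑-vertices f) n ≡ vertices r .apply (λ u → seq (f u) n)
seq-∑-vertices f n = seq-∑⁴ (λ i j k l → f (i , j , k , l)) n

seq-∑-edges : ∀ {r} (f : Edge r → ℝ) n → seq (∑-edges f) n ≡ edges r .apply (λ e → seq (f e) n)
seq-∑-edges f n = cong₂ ℚ._+_
  (cong₂ ℚ._+_ (seq-∑³ (λ i j k → f (e₀ i j k)) n) (seq-∑³ (λ i j k → f (e₁ i j k)) n))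
  (seq-∑⁴ (λ i j k₀ k₁ → f (e₀₁ i j k₀ k₁)) n)

-- Signs

Config : ℕ → Set
Config r = Vertex r → Sign

value : ∀ {r} → Config r → Term r → Sign
value S (inj₁ e) = S (proj₁ (endpoints e)) Sign.* S (proj₂ (endpoints e))
value S (inj₂ u) = S u

infixl 7 _·_
_·_ : ∀ {r} → Config r → Config r → Config r
(S · χ) u = S u Sign.* χ u

*-interchange : ∀ s t u v → (s Sign.* t) Sign.* (u Sign.* v) ≡ (s Sign.* u) Sign.* (t Sign.* v)
*-interchange = interchange
  where open import Algebra.Properties.CommutativeSemigroup Sign.*-commutativeSemigroup

-- Each term is a monomial in the spins, hence multiplicative in the configuration.
value-· : ∀ {r} (S χ : Config r) t → value (S · χ) t ≡ value S t Sign.* value χ t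
value-· S χ (inj₁ e) = *-interchange (S (proj₁ (endpoints e))) _ (S (proj₂ (endpoints e))) _
value-· S χ (inj₂ u) = refl

signed : Sign → ℚ → ℚ
signed Sign.+ q = q
signed Sign.- q = ℚ.- q

keep : Sign → ℚ → ℚ
keep Sign.+ q = q
keep Sign.- q = 0ℚ

keep-0 : ∀ s → keep s 0ℚ ≡ 0ℚ
keep-0 Sign.+ = refl
keep-0 Sign.- = refl

keep-opposite : ∀ s q → keep s q ℚ.+ keep (opposite s) q ≡ q
keep-opposite Sign.+ q = ℚ.+-identityʳ q
keep-opposite Sign.- q = ℚ.+-identityˡ q

-- The two summands agree when `t` is + and cancel when it is -. The mean is stated doubled, which
-- avoids division.
keep-mean : ∀ s t q →
  signed s q ℚ.+ signed (s Sign.* t) q ≡ keep t (signed s q) ℚ.+ keep t (signed s q)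
keep-mean Sign.+ Sign.+ q = refl
keep-mean Sign.- Sign.+ q = refl
keep-mean Sign.+ Sign.- q = ℚ.+-inverseʳ q
keep-mean Sign.- Sign.- q = ℚ.+-inverseˡ q

against : ∀ q → ∃ λ s → signed s q ≡ ℚ.- ℚ.∣ q ∣
against q with ℚ.∣p∣≡p∨∣p∣≡-p q
... | inj₁ eq = Sign.- , cong ℚ.-_ (sym eq)
... | inj₂ eq = Sign.+ , trans (solve 1 (λ q → q := :- (:- q)) refl q) (cong ℚ.-_ (sym eq))

-- The effect on one term of averaging over every `χ` in the list: it survives only if all of them
-- are + on it.
mask : ∀ {r} → List (Config r) → Term r → ℚ → ℚ
mask []       t q = q
mask (χ ∷ χs) t q = keep (value χ t) (mask χs t q)

-- If some `χ` already deletes `t`, both sides vanish; otherwise this is `keep-mean`.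
mask-mean : ∀ {r} (χs : List (Config r)) t s u q →
  mask χs t (signed s q) ℚ.+ mask χs t (signed (s Sign.* u) q)
    ≡ keep u (mask χs t (signed s q)) ℚ.+ keep u (mask χs t (signed s q))
mask-mean []       t s u q = keep-mean s u q
mask-mean (χ ∷ χs) t s u q with value χ t
... | Sign.+ = mask-mean χs t s u q
... | Sign.- = cong₂ ℚ._+_ (sym (keep-0 u)) (sym (keep-0 u))

-- Sign patterns along paths and at single indices

parity : ∀ {n} → Fin n → Sign
parity zero    = Sign.+
parity (suc i) = opposite (parity i)

parity-inject₁ : ∀ {n} (i : Fin n) → parity (inject₁ i) ≡ parity i
parity-inject₁ zero    = refl
parity-inject₁ (suc i) = cong opposite (parity-inject₁ i)

parity-step : ∀ {n} (i : Fin n) → parity (inject₁ i) ≢ parity (suc i)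
parity-step i h = Sign.s≢opposite[s] (parity i) (trans (sym (parity-inject₁ i)) h)

walk : ∀ {n} → (Fin n → Sign) → Fin (ℕ.suc n) → Sign
walk {n}       w zero    = Sign.+
walk {ℕ.suc n} w (suc i) = w zero Sign.* walk (w ∘ suc) i

-- The spins are prefix products of `w`, so common factors square to +. Thus the edges of a path can
-- be given any signs.
walk-step : ∀ {n} (w : Fin n → Sign) i → walk w (inject₁ i) Sign.* walk w (suc i) ≡ w i
walk-step w zero    = Sign.*-identityʳ (w zero)
walk-step w (suc i) = begin
  (w zero Sign.* a) Sign.* (w zero Sign.* b)  ≡⟨ *-interchange (w zero) a (w zero) b ⟩
  (w zero Sign.* w zero) Sign.* (a Sign.* b)  ≡⟨ cong (Sign._* (a Sign.* b)) (Sign.s*s≡+ (w zero)) ⟩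
  a Sign.* b                                  ≡⟨ walk-step (w ∘ suc) i ⟩
  w (suc i)                                   ∎
  where
  open ≡-Reasoning
  a = walk (w ∘ suc) (inject₁ i)
  b = walk (w ∘ suc) (suc i)

δ : ∀ {n} → Fin n → Fin n → Sign
δ i j = if does (i Fin.≟ j) then Sign.+ else Sign.-

keep-δ : ∀ {n} (i j : Fin n) (f : Fin n → ℚ) → keep (δ i j) (f i) ≡ keep (δ i j) (f j)
keep-δ i j f with i Fin.≟ j
... | yes refl = refl
... | no _     = refl

-- The eight classes of terms

-- Here `a` and `m` stand for the coefficients and `H*` at one index of their sequences.
module Bounds {r} (a : Term (ℕ.suc r) → ℚ) (m : ℚ)
  (m≤ : ∀ S → m ℚ.≤ terms (ℕ.suc r) .apply (λ t → signed (value S t) (a t))) where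

  total : (Term (ℕ.suc r) → ℚ) → ℚ
  total = terms (ℕ.suc r) .apply

  -- A record rather than an abbreviation, so that `q` and `g` can be recovered by unification.
  record Bound (q : ℚ) (g : Term (ℕ.suc r) → ℚ) : Set where
    constructor bound
    field bound⁻¹ : q ℚ.* m ℚ.≤ total g
  open Bound public

  bound-resp : ∀ {q g h} → g ≗ h → Bound q g → Bound q h
  bound-resp g≗h (bound b) = bound (subst (_ ℚ.≤_) (terms _ .apply-cong g≗h) b)

  bound-+ : ∀ {p q g h} → Bound p g → Bound q h → Bound (p ℚ.+ q) (λ t → g t ℚ.+ h t)
  bound-+ {p} {q} {g} {h} (bound b) (bound b′) = bound (subst₂ ℚ._≤_ (sym (ℚ.*-distribʳ-+ m p q))
    (sym (terms _ .apply-+ g h)) (ℚ.+-mono-≤ b b′))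

  bound-½ : ∀ {g} → Bound (1ℚ ℚ.+ 1ℚ) (λ t → g t ℚ.+ g t) → Bound 1ℚ g
  bound-½ {g} (bound b) = bound (subst (ℚ._≤ total g) (sym (ℚ.*-identityˡ m))
    (ℚ.*-cancelˡ-≤-pos (1ℚ ℚ.+ 1ℚ) (subst (_ ℚ.≤_)
      (trans (terms _ .apply-+ g g) (solve 1 (λ x → x :+ x := con (1ℚ ℚ.+ 1ℚ) :* x) refl (total g))) b)))

  -- By induction on the list: the bounds for `S` and `S · χ` are added and halved.
  masked : ∀ χs S → Bound 1ℚ (λ t → mask χs t (signed (value S t) (a t)))
  masked []       S = bound (subst (ℚ._≤ _) (sym (ℚ.*-identityˡ m)) (m≤ S))
  masked (χ ∷ χs) S = bound-½ (bound-resp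
    (λ t → trans (cong (λ s → mask χs t (signed (value S t) (a t)) ℚ.+ mask χs t (signed s (a t))) (value-· S χ t))
      (mask-mean χs t (value S t) (value χ t) (a t)))
    (bound-+ (masked χs S) (masked χs (S · χ))))

  -- The constant −1 is +1 on edges and −1 on vertices, so it deletes the fields.
  edgesOnly : ∀ χ S → Bound 1ℚ
    [ (λ e → keep (value χ (inj₁ e)) (signed (value S (inj₁ e)) (a (inj₁ e)))) , (λ _ → 0ℚ) ]′
  edgesOnly χ S = bound-resp (λ { (inj₁ e) → refl ; (inj₂ u) → refl })
    (masked (const Sign.- ∷ χ ∷ []) S)

  -∣a∣ : Term (ℕ.suc r) → ℚ
  -∣a∣ t = ℚ.- ℚ.∣ a t ∣

  sgn : Term (ℕ.suc r) → Sign
  sgn t = proj₁ (against (a t))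

  delete : ∀ {s t q} → s ≢ t → keep (s Sign.* t) q ≡ 0ℚ
  delete {Sign.+} {Sign.+} s≢t = contradiction refl s≢t
  delete {Sign.+} {Sign.-} s≢t = refl
  delete {Sign.-} {Sign.+} s≢t = refl
  delete {Sign.-} {Sign.-} s≢t = contradiction refl s≢t

  attain : ∀ t {s u} → s ≡ Sign.+ → u ≡ sgn t → keep s (signed u (a t)) ≡ -∣a∣ t
  attain t refl refl = proj₂ (against (a t))

  rows columns : Term (ℕ.suc r) → ℚ
  rows    t@(inj₁ (e₀ _ _ _)) = -∣a∣ t
  rows    _                   = 0ℚ
  columns t@(inj₁ (e₁ _ _ _)) = -∣a∣ t
  columns _                   = 0ℚ

  star : Fin 4 → Term (ℕ.suc r) → ℚ
  star k t@(inj₁ (e₀₁ _ _ k₀ _)) = keep (δ k k₀) (-∣a∣ t)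
  star k _                       = 0ℚ

  -- The proper 2-colouring of the graph: every edge changes exactly one of the parities of `i`, `j`
  -- and `l`.
  colour : Config (ℕ.suc r)
  colour (i , j , k , l) = (parity i Sign.* parity j) Sign.* parity l

  fields : Sign → Term (ℕ.suc r) → ℚ
  fields s (inj₁ _)   = 0ℚ
  fields s t@(inj₂ u) = keep (s Sign.* colour u) (-∣a∣ t)

  same : ∀ s t → (s Sign.* t) Sign.* (s Sign.* t) ≡ Sign.+
  same s t = Sign.s*s≡+ (s Sign.* t)

  changeʳ : ∀ s {t u} → t ≢ u → s Sign.* t ≢ s Sign.* u
  changeʳ s t≢u = t≢u ∘ Sign.*-cancelˡ-≡ s _ _

  changeˡ : ∀ {s t} u → s ≢ t → s Sign.* u ≢ t Sign.* u
  changeˡ u s≢t = s≢t ∘ Sign.*-cancelʳ-≡ u _ _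

  rows-bound : Bound 1ℚ rows
  rows-bound = bound-resp eq (edgesOnly χ S)
    where
    χ S : Config (ℕ.suc r)
    -- Constant along E₀, but changing sign along E₁ (through `j`) and along E₀₁ (through `l`).
    χ (i , j , k , l) = parity j Sign.* parity l
    S (i , j , k , zero)  = walk (λ i′ → sgn (inj₁ (e₀ i′ j k))) i
    S (i , j , k , suc _) = Sign.+
    eq : _ ≗ rows
    eq (inj₁ (e₀ i j k))      = attain _ (same (parity j) Sign.+) (walk-step _ i)
    eq (inj₁ (e₁ i j k))      = delete (changeˡ Sign.- (parity-step j))
    eq (inj₁ (e₀₁ i j k₀ k₁)) = delete (changeʳ (parity j) λ ())
    eq (inj₂ _)               = refl

  columns-bound : Bound 1ℚ columns
  columns-bound = bound-resp eq (edgesOnly χ S)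
    where
    χ S : Config (ℕ.suc r)
    χ (i , j , k , l) = parity i Sign.* parity l
    S (i , j , k , zero)  = Sign.+
    S (i , j , k , suc _) = walk (λ j′ → sgn (inj₁ (e₁ i j′ k))) j
    eq : _ ≗ columns
    eq (inj₁ (e₀ i j k))      = delete (changeˡ Sign.+ (parity-step i))
    eq (inj₁ (e₁ i j k))      = attain _ (same (parity i) Sign.-) (walk-step _ j)
    eq (inj₁ (e₀₁ i j k₀ k₁)) = delete (changeʳ (parity i) λ ())
    eq (inj₂ _)               = refl

  star-bound : ∀ k → Bound 1ℚ (star k)
  star-bound k* = bound-resp eq (edgesOnly χ S)
    where
    χ S : Config (ℕ.suc r)
    -- The parities delete E₀ and E₁ and cancel within a cell, where `δ` selects the edges at `k*`.
    χ (i , j , k , zero)  = (parity i Sign.* parity j) Sign.* δ k* k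
    χ (i , j , k , suc _) = (parity i Sign.* parity j) Sign.* Sign.+
    -- Centres get +, so each leaf is free to carry the sign that its one surviving edge requires.
    S (i , j , k , zero)  = Sign.+
    S (i , j , k , suc _) = sgn (inj₁ (e₀₁ i j k* k))
    eq : _ ≗ star k*
    eq (inj₁ (e₀ i j k))      = delete (changeˡ (δ k* k) (changeˡ (parity j) (parity-step i)))
    eq (inj₁ (e₁ i j k))      = delete (changeˡ Sign.+ (changeʳ (parity i) (parity-step j)))
    eq (inj₁ (e₀₁ i j k k₁))  = trans
      (cong (λ s → keep s _) (trans (*-interchange p (δ k* k) p Sign.+)
        (cong₂ Sign._*_ (Sign.s*s≡+ p) (Sign.*-identityʳ (δ k* k)))))
      -- The leaf was chosen for the centre `k*`; wherever `δ` keeps the edge, `k*` is `k`.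
      (trans (keep-δ k* k (λ k′ → signed (sgn (inj₁ (e₀₁ i j k′ k₁))) (a (inj₁ (e₀₁ i j k k₁)))))
        (cong (keep (δ k* k)) (proj₂ (against (a (inj₁ (e₀₁ i j k k₁)))))))
      where p = parity i Sign.* parity j
    eq (inj₂ _)               = refl

  fields-bound : ∀ s → Bound 1ℚ (fields s)
  fields-bound s = bound-resp eq (masked (χ ∷ []) (sgn ∘ inj₂))
    where
    χ : Config (ℕ.suc r)
    χ u = s Sign.* colour u
    eq : _ ≗ fields s
    -- As `χ` is a proper colouring up to sign, it is - on every edge.
    eq (inj₁ (e₀ i j k))      = delete (changeʳ s (changeˡ Sign.+ (changeˡ (parity j) (parity-step i))))
    eq (inj₁ (e₁ i j k))      = delete (changeʳ s (changeˡ Sign.- (changeʳ (parity i) (parity-step j))))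
    eq (inj₁ (e₀₁ i j k₀ k₁)) = delete (changeʳ s (changeʳ (parity i Sign.* parity j) λ ()))
    eq (inj₂ u)               = cong (keep (s Sign.* colour u)) (proj₂ (against (a (inj₂ u))))

  total-bound : Bound (+ 8 / 1) -∣a∣
  total-bound = bound-resp eq
    (bound-+ rows-bound (bound-+ columns-bound
      (bound-+ (star-bound 0F) (bound-+ (star-bound 1F) (bound-+ (star-bound 2F) (bound-+ (star-bound 3F)
        (bound-+ (fields-bound Sign.+) (fields-bound Sign.-))))))))
    where
    0+x : ∀ {x y} → x ≡ y → 0ℚ ℚ.+ x ≡ y
    0+x h = trans (ℚ.+-identityˡ _) h
    x+0 : ∀ {x} → x ℚ.+ 0ℚ ≡ x
    x+0 = ℚ.+-identityʳ _
    eq : _ ≗ -∣a∣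
    eq (inj₁ (e₀ _ _ _))     = x+0
    eq (inj₁ (e₁ _ _ _))     = 0+x x+0
    eq (inj₁ (e₀₁ _ _ 0F _)) = 0+x (0+x x+0)
    eq (inj₁ (e₀₁ _ _ 1F _)) = 0+x (0+x (0+x x+0))
    eq (inj₁ (e₀₁ _ _ 2F _)) = 0+x (0+x (0+x (0+x x+0)))
    eq (inj₁ (e₀₁ _ _ 3F _)) = 0+x (0+x (0+x (0+x (0+x x+0))))
    -- Exactly one of the two colour classes contains `u`.
    eq (inj₂ u)              = 0+x (0+x (0+x (0+x (0+x (0+x (keep-opposite (colour u) _))))))

8m-≤ : ∀ r .{{_ : NonZero r}} (a : Term r → ℚ) m →
  (∀ S → m ℚ.≤ terms r .apply (λ t → signed (value S t) (a t))) →
  + 8 / 1 ℚ.* m ℚ.≤ ℚ.- terms r .apply (λ t → ℚ.∣ a t ∣)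
8m-≤ (ℕ.suc r) a m m≤ = subst (+ 8 / 1 ℚ.* m ℚ.≤_) (apply-neg (terms (ℕ.suc r)) (λ t → ℚ.∣ a t ∣))
  (bound⁻¹ total-bound)
  where open Bounds a m m≤

-- Energies of configurations

-- A general relation replaces equality because the listed functions match only pointwise, and the
-- lemma is iterated over four nested levels.
functions-complete : ∀ {A B : Set} {_∼_ : A → B → Set} {xs} → (∀ b → Any (_∼ b) xs) →
  ∀ n (f : Fin n → B) → Any (λ g → ∀ i → g i ∼ f i) (functions xs n)
functions-complete h ℕ.zero    f = here λ ()
functions-complete h (ℕ.suc n) f = Any.cartesianProductWith⁺ Vector._∷_
  (λ { x∼ g∼ zero → x∼ ; x∼ g∼ (suc i) → g∼ i })
  (h (f zero)) (functions-complete h n (f ∘ suc))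

configurations-complete : ∀ {r} (S : Config r) → Any (_≗ S) (configurations r)
configurations-complete {r} S = Any.map⁺ (Any.map (λ h (i , j , k , l) → h i j k l)
  (functions-complete (functions-complete (functions-complete (functions-complete sign 2) 4) r) r
    (λ i j k l → S (i , j , k , l))))
  where
  sign : ∀ s → Any (_≡ s) (Sign.+ ∷ Sign.- ∷ [])
  sign Sign.+ = here refl
  sign Sign.- = there (here refl)

foldr-⊓-≤ : ∀ b {xs q} n → Any (λ x → seq x n ℚ.≤ q) xs → seq (List.foldr _⊓_ b xs) n ℚ.≤ q
foldr-⊓-≤ b {x ∷ xs} n (here h)  = ℚ.≤-trans (ℚ.p⊓q≤p (seq x n) (seq (List.foldr _⊓_ b xs) n)) h
foldr-⊓-≤ b {x ∷ xs} n (there h) =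
  ℚ.≤-trans (ℚ.p⊓q≤q (seq x n) (seq (List.foldr _⊓_ b xs) n)) (foldr-⊓-≤ b n h)

coefficient : ∀ {r} → (Edge r → ℝ) → (Vertex r → ℝ) → Term r → ℝ
coefficient c d = [ c , d ]′

spin-signed : ∀ s q n → q ℚ.* seq (spin s) n ≡ signed s q
spin-signed Sign.+ q n = ℚ.*-identityʳ q
spin-signed Sign.- q n = solve 1 (λ q → q :* con (ℚ.- 1ℚ) := :- q) refl q

signed-signed : ∀ s t q → signed t (signed s q) ≡ signed (s Sign.* t) q
signed-signed Sign.+ t      q = refl
signed-signed Sign.- Sign.+ q = refl
signed-signed Sign.- Sign.- q = solve 1 (λ q → :- (:- q) := q) refl q

seq-energy : ∀ {r} c d {S T : Config r} → S ≗ T → ∀ n →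
  seq (energy c d S) n ≡ terms r .apply (λ t → signed (value T t) (seq (coefficient c d t) n))
seq-energy {r} c d {S} {T} S≗T n = cong₂ ℚ._+_
  (trans (seq-∑-edges (λ e → c e * spin (S (proj₁ (endpoints e))) * spin (S (proj₂ (endpoints e)))) n)
    (edges r .apply-cong edge))
  (trans (seq-∑-vertices (λ u → d u * spin (S u)) n) (vertices r .apply-cong vertex))
  where
  edge : ∀ e → seq (c e * spin (S (proj₁ (endpoints e))) * spin (S (proj₂ (endpoints e)))) n
    ≡ signed (value T (inj₁ e)) (seq (c e) n)
  edge e = begin
    seq (c e) n ℚ.* seq (spin (S u)) n ℚ.* seq (spin (S v)) n
      ≡⟨ spin-signed (S v) _ n ⟩
    signed (S v) (seq (c e) n ℚ.* seq (spin (S u)) n)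
      ≡⟨ cong (signed (S v)) (spin-signed (S u) (seq (c e) n) n) ⟩
    signed (S v) (signed (S u) (seq (c e) n))
      ≡⟨ signed-signed (S u) (S v) (seq (c e) n) ⟩
    signed (S u Sign.* S v) (seq (c e) n)
      ≡⟨ cong₂ (λ s t → signed (s Sign.* t) (seq (c e) n)) (S≗T u) (S≗T v) ⟩
    signed (T u Sign.* T v) (seq (c e) n)
      ∎
    where
    open ≡-Reasoning
    u = proj₁ (endpoints e)
    v = proj₂ (endpoints e)
  vertex : ∀ u → seq (d u * spin (S u)) n ≡ signed (T u) (seq (d u) n)
  vertex u = trans (spin-signed (S u) (seq (d u) n) n) (cong (λ s → signed s (seq (d u) n)) (S≗T u))

H*-≤ : ∀ {r} c d n (S : Config r) →
  seq (H* r c d) n ℚ.≤ terms r .apply (λ t → signed (value S t) (seq (coefficient c d t) n))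
H*-≤ c d n S = foldr-⊓-≤ (energy c d (λ _ → Sign.+)) n (Any.map⁺ (Any.map (λ h → ℚ.≤-reflexive (seq-energy c d h n))
  (configurations-complete S)))

8H*-≤ : ∀ r .{{_ : NonZero r}} c d n → + 8 / 1 ℚ.* seq (H* r c d) n ℚ.≤
  ℚ.- seq (∑-edges (λ e → ∣ c e ∣) + ∑-vertices (λ u → ∣ d u ∣)) n
8H*-≤ r c d n = subst (λ x → + 8 / 1 ℚ.* seq (H* r c d) n ℚ.≤ ℚ.- x)
  (sym (cong₂ ℚ._+_ (seq-∑-edges (λ e → ∣ c e ∣) n) (seq-∑-vertices (λ u → ∣ d u ∣) n)))
  (8m-≤ r (λ t → seq (coefficient c d t) n) (seq (H* r c d) n) (H*-≤ c d n))

-- The constant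

open Estimates using (*-monoʳ; *-monoˡ; *-mono; 0≤*; 0≤/; /-≤; inverseˡ; 0≤inverse; inverse-≤;
  ⌊√⌋-lower; 0≤odd; odd≤1; p≤∣p∣)

-- With `k` the denominator, `t` > 2`k` would give `t`² > 4`k`² ≥ 2`k`² ≥ `t`².
√2-≤ : ∀ n → √-approx 2 n ℚ.≤ + 2 / 1
√2-≤ n = /-≤ t (ℕ.suc n) 2 1 (ℕ.≮⇒≥ λ 2k<t → ℕ.<⇒≱
  (ℕ.*-mono-< (subst (k ℕ.+ (k ℕ.+ 0) ℕ.<_) (ℕ.*-identityʳ t) 2k<t) (subst (k ℕ.+ (k ℕ.+ 0) ℕ.<_) (ℕ.*-identityʳ t) 2k<t))
  (ℕ.≤-trans (⌊√⌋-lower (2 ℕ.* (k ℕ.* k)))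
    (subst (ℕ._≤ 2 ℕ.* k ℕ.* (2 ℕ.* k)) (ℕ.*-assoc 2 k k)
      (ℕ.*-monoʳ-≤ (2 ℕ.* k) (ℕ.m≤m+n k (k ℕ.+ 0))))))
  where
  k = ℕ.suc n
  t = ⌊√ 2 ℕ.* (k ℕ.* k) ⌋

-- This is the `artanh` argument for ln(1+`s`), which simplifies to `s`/(`s`+2).
möbius-range : ∀ {s} → 0ℚ ℚ.≤ s → s ℚ.≤ + 2 / 1 → let z = (1ℚ ℚ.+ s ℚ.+ ℚ.- 1ℚ) ℚ.* inverse (1ℚ ℚ.+ s ℚ.+ 1ℚ) in
  0ℚ ℚ.≤ z × z ℚ.≤ ½
möbius-range {s} 0≤s s≤2 =
    subst (0ℚ ℚ.≤_) (sym z≡) (0≤* 0≤s 0≤i)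
  , subst₂ ℚ._≤_ (sym z≡) (trans (ℚ.*-assoc ½ w i)
      (trans (cong (½ ℚ.*_) (trans (ℚ.*-comm w i) (inverseˡ 0<w))) (ℚ.*-identityʳ ½)))
      (*-monoˡ 0≤i s≤½w)
  where
  w = 1ℚ ℚ.+ s ℚ.+ 1ℚ
  i = inverse w
  0<w : 0ℚ ℚ.< w
  0<w = ℚ.+-mono-≤-< (ℚ.+-mono-≤ (ℚ.nonNegative⁻¹ 1ℚ) 0≤s) (ℚ.positive⁻¹ 1ℚ)
  0≤i = 0≤inverse 0<w
  z≡ : (1ℚ ℚ.+ s ℚ.+ ℚ.- 1ℚ) ℚ.* i ≡ s ℚ.* i
  z≡ = cong (ℚ._* i) (solve 1 (λ s → (con 1ℚ :+ s) :+ con (ℚ.- 1ℚ) := s) refl s)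
  s≤½w : s ℚ.≤ ½ ℚ.* w
  s≤½w = subst₂ ℚ._≤_ (solve 1 (λ s → con ½ :* (s :+ s) := s) refl s)
    (cong (½ ℚ.*_) (solve 1 (λ s → s :+ con (+ 2 / 1) := (con 1ℚ :+ s) :+ con 1ℚ) refl s))
    (*-monoʳ (ℚ.nonNegative⁻¹ ½) (ℚ.+-monoʳ-≤ s s≤2))

-- Comparison with the geometric series of ratio 1/4: its sum 4/3 satisfies 1 + 1/4 · 4/3 = 4/3.
partialSum-range : ∀ {a w} → (∀ k → 0ℚ ℚ.≤ a k) → (∀ k → a k ℚ.≤ 1ℚ) → 0ℚ ℚ.≤ w → w ℚ.≤ + 1 / 4 →
  ∀ n → 0ℚ ℚ.≤ partialSum a n w × partialSum a n w ℚ.≤ + 4 / 3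
partialSum-range 0≤a a≤1 0≤w w≤¼ ℕ.zero    = ℚ.≤-refl , ℚ.nonNegative⁻¹ _
partialSum-range 0≤a a≤1 0≤w w≤¼ (ℕ.suc n) =
  let 0≤p , p≤ = partialSum-range (0≤a ∘ ℕ.suc) (a≤1 ∘ ℕ.suc) 0≤w w≤¼ n
  in ℚ.+-mono-≤ (0≤a 0) (0≤* 0≤w 0≤p)
   , ℚ.+-mono-≤ (a≤1 0) (*-mono 0≤w (ℚ.nonNegative⁻¹ _) w≤¼ p≤)

ln[1+√2]/π-≤ : ∀ n → 1 ℕ.≤ n →
  seq (ln (fromℕ 1 + √ 2) (1+√-positive 2) ÷ π [ π-positive ]) n ℚ.≤ ½
ln[1+√2]/π-≤ n 1≤n =
  let 0≤z , z≤½ = möbius-range (0≤/ ⌊√ 2 ℕ.* (ℕ.suc n ℕ.* ℕ.suc n) ⌋ (ℕ.suc n)) (√2-≤ n)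
      0≤p , p≤  = partialSum-range 0≤odd (λ k → ℚ.≤-trans (p≤∣p∣ _) (odd≤1 k))
                    (0≤* 0≤z 0≤z) (*-mono 0≤z (ℚ.nonNegative⁻¹ ½) z≤½ z≤½) n
  -- The bounds multiply to 2 · (1/2 · 4/3) · 3/8 = 1/2. Index 0 is excluded because the empty
  -- partial sum for π is 0.
  in *-mono (0≤* (ℚ.nonNegative⁻¹ (+ 2 / 1)) (0≤* 0≤z 0≤p)) (ℚ.nonNegative⁻¹ (+ 3 / 8))
       (*-monoʳ (ℚ.nonNegative⁻¹ (+ 2 / 1)) (*-mono 0≤z (ℚ.nonNegative⁻¹ (+ 4 / 3)) z≤½ p≤))
       (inverse-≤ (ℚ.positive⁻¹ (+ 8 / 3)) (ℚ.positive⁻¹ (+ 3 / 8)) refl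
         (proj₂ (proj₂ (proj₂ π-positive)) n 1≤n))

≤-eighth : ∀ {h x ε} → 0ℚ ℚ.< ε → + 8 / 1 ℚ.* h ℚ.≤ ℚ.- x → h ℚ.≤ ℚ.- (+ 1 / 8) ℚ.* x ℚ.+ ε
≤-eighth {h} {x} {ε} 0<ε 8h≤-x = subst (ℚ._≤ ℚ.- (+ 1 / 8) ℚ.* x ℚ.+ ε) (ℚ.+-identityʳ h)
  (ℚ.+-mono-≤ h≤ (ℚ.<⇒≤ 0<ε))
  where
  h≤ : h ℚ.≤ ℚ.- (+ 1 / 8) ℚ.* x
  h≤ = ℚ.*-cancelˡ-≤-pos (+ 8 / 1) (subst (+ 8 / 1 ℚ.* h ℚ.≤_)
    (solve 1 (λ x → :- x := con (+ 8 / 1) :* (con (ℚ.- (+ 1 / 8)) :* x)) refl x) 8h≤-x)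

theorem2 : Σ ℝ λ C → Σ (fromℕ 0 < C) λ C>0 →
    ln (fromℕ 1 + √ 2) (1+√-positive 2) ÷ π [ π-positive ] < C
    × ((r : ℕ) .{{_ : NonZero r}} (c : Edge r → ℝ) (d : Vertex r → ℝ) →
    H* r c d
    ≤ - (C ÷ (fromℕ 3 * C + fromℕ 4) [ 3x+4-positive C C>0 ])
    * (∑-edges (λ e → ∣ c e ∣) + ∑-vertices (λ u → ∣ d u ∣)))
    × (fromℕ 3 * C + fromℕ 4) ÷ C [ C>0 ] < fromℚ (+ 1726 / 100)
theorem2 = fromℚ (+ 4 / 5) , (+ 4 / 5 , ℚ.positive⁻¹ _ , 0 , λ _ _ → ℚ.≤-refl)
  -- The gap is 4/5 - 1/2 = 3/10.
  , (+ 3 / 10 , ℚ.positive⁻¹ _ , 1 , λ n 1≤n → ℚ.+-monoˡ-≤ (+ 3 / 10) (ln[1+√2]/π-≤ n 1≤n))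
  , (λ r c d ε 0<ε → 0 , λ n _ → ≤-eighth 0<ε (8H*-≤ r c d n))
  -- The factor evaluates to 8 at every index, so 8 + 1 ≤ 17.26 is decided by computation.
  , (1ℚ , ℚ.positive⁻¹ 1ℚ , 0 , λ _ _ → ℚ.≤ᵇ⇒≤ _)
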